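{- For every $C>0$ and every $\epsilon>0$ there is $n_0$ such that for every integer $n>n_0$ and every integer $m$ with $n\le m\le n^{1/\epsilon}$ we have $$m^{2-\epsilon}\le s(n,m)\le \frac{m^2}{C}.$$ (Informally: for $n\le m\le n^{O(1)}$, $s(n,m)=m^2/w(m)$ where $w(m)\to\infty$ and $w(m)$ is smaller than any polynomial in $m$.)
   Context: A hypergraph $H=(V,E)$ consists of a finite vertex set $V$ and a set $E$ of distinct subsets of $V$ (hyperedges). A labeling $f:V\to\mathbb{N}=\{1,2,\dots\}$ is sum-distinguishing if $\sum_{v\in e}f(v)\neq\sum_{v\in e'}f(v)$ for any two distinct hyperedges $e,e'\in E$. Let $s(H)$ be the smallest integer $N$ such that $H$ has a sum-distinguishing labeling with all labels in $\{1,\dots,N\}$. Let $s(n,m)$ be the maximum of $s(H)$ over all hypergraphs $H$ with $n$ vertices and $m$ hyperedges. -}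

module Defs where

open import Data.Nat using (ℕ; zero; suc; _+_; _≤_)
open import Data.Bool using (Bool; true; false)
open import Data.Fin using (Fin; zero; suc)
open import Data.Fin.Subset using (Subset)
open import Data.Vec using ([]; _∷_)
open import Data.Product using (Σ; _×_; ∃)
open import Relation.Binary.PropositionalEquality using (_≡_; _≢_)
open import Function using (_∘_)

record Hypergraph (n m : ℕ) : Set where
  field
    edge     : Fin m → Subset n
    distinct : ∀ (i j : Fin m) → i ≢ j → edge i ≢ edge j
open Hypergraph public

labelSum : ∀ {n} → Subset n → (Fin n → ℕ) → ℕ
labelSum [] f = 0
labelSum (true ∷ e) f = f zero + labelSum e (f ∘ suc)
labelSum (false ∷ e) f = labelSum e (f ∘ suc)

SumDistinguishing : ∀ {n m} → Hypergraph n m → (Fin n → ℕ) → Set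
SumDistinguishing {n} {m} H f =
  ∀ (i j : Fin m) → i ≢ j → labelSum (edge H i) f ≢ labelSum (edge H j) f

Labelable : ∀ {n m} → Hypergraph n m → ℕ → Set
Labelable {n} H N =
  Σ (Fin n → ℕ) λ f → (∀ v → 1 ≤ f v × f v ≤ N) × SumDistinguishing H f

IsS : ∀ {n m} → Hypergraph n m → ℕ → Set
IsS H N = Labelable H N × (∀ N' → Labelable H N' → N ≤ N')

IsSnm : ℕ → ℕ → ℕ → Set
IsSnm n m N =
  (Σ (Hypergraph n m) λ H → IsS H N)
  × (∀ (H : Hypergraph n m) N' → IsS H N' → N' ≤ N)

{-# OPTIONS --safe #-}
-- Upper bound. Let M be about m²/2C and look for labels r + M z with 1 ≤ r ≤ M and z ∈ {0, 1}.
-- Call two edges near if they differ in fewer than K vertices, where K depends only on C.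
-- Since each near pair involves fewer than K vertices, only boundedly many vertices separate
-- more than M/2 near pairs; these get distinct powers of two. The other residues r are chosen
-- one vertex at a time, so that near pairs never collide modulo M while far pairs collide at
-- most about twice as often as on average, that is, boundedly often. Each of those boundedly
-- many far pairs differs in so many vertices that the digits z can be chosen to separate them.
--
-- Lower bound. Only O(log m) vertices X ⊔ Y are used. For a labelling with small labels that
-- is injective on 2^Y, at least half of the sets c ⊆ X are good: the block {c} × 2^Y shares
-- its sums with many other subsets of X ⊔ Y. Greedily, polylogarithmically many sets c contain a
-- good one for every labelling, and fewer than m further edges hit the corresponding sums for
-- every labelling. Hence labels up to m² / polylog(m) do not suffice.

module Submission where

open import Defs
open import Data.Bool using (Bool; true; false; not; _∧_; _∨_; _xor_; if_then_else_; T)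
open import Data.Bool.ListAction using (any)
import Data.Bool.Properties as Bool
open import Data.Empty using (⊥; ⊥-elim)
open import Data.Fin using (Fin; zero; suc; toℕ; fromℕ<; _↑ˡ_; _↑ʳ_)
import Data.Fin.Properties as Fin
open import Data.Fin.Properties using (toℕ<n; toℕ-fromℕ<)
open import Data.Fin.Subset using (Subset)
import Data.List as List
open import Data.List using (List; []; _∷_; _++_; length; map; filterᵇ; cartesianProduct; cartesianProductWith; downFrom; allFin; take; deduplicate)
open import Data.List.Membership.Propositional using (_∈_; lose; find)
open import Data.List.Membership.Propositional.Properties using (∈-map⁺; ∈-map⁻; ∈-downFrom⁻; ∈-++⁺ˡ; ∈-++⁺ʳ; ∈-allFin; ∈-cartesianProductWith⁺; ∈-filter⁺; ∈-filter⁻; ∈-deduplicate⁺; ∈-lookup)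
open import Data.List.Properties using (length-map; length-++; length-downFrom; length-filter; length-tabulate; length-take; length-deduplicate)
open import Data.List.Relation.Unary.All as All using (All; all?)
open import Data.List.Relation.Unary.AllPairs using ([]; _∷_)
open import Data.List.Relation.Unary.Any as Any using (here; there; index; any?)
open import Data.List.Relation.Unary.Any.Properties using (lookup-index)
open import Data.List.Relation.Unary.Unique.DecPropositional.Properties using (deduplicate-!)
open import Data.List.Relation.Unary.Unique.Propositional using (Unique)
open import Data.List.Relation.Unary.Unique.Propositional.Properties using (downFrom⁺; cartesianProductWith⁺; ++⁺; take⁺; filter⁺)
open import Data.Nat using (ℕ; zero; suc; _+_; _*_; _^_; _∸_; _≤_; _<_; z≤n; s≤s; _≡ᵇ_; _<ᵇ_; _≤?_; _<?_; _≟_; NonZero; _%_; _/_; >-nonZero; >-nonZero⁻¹)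
open import Data.Nat.DivMod
open import Data.Nat.Properties
open import Data.Nat.Tactic.RingSolver using (solve-∀)
open import Data.Product using (Σ; _×_; _,_; proj₁; proj₂; uncurry)
open import Data.Sum using (_⊎_; inj₁; inj₂; [_,_]′)
open import Data.Unit using (tt)
import Data.Vec as Vec
open import Data.Vec using (Vec; []; _∷_; head; tail; lookup; tabulate; zipWith)
open import Data.Vec.Functional using () renaming (_∷_ to _▹_)
import Data.Vec.Properties as Vec
open import Data.Vec.Properties using (lookup∘tabulate)
open import Function using (_∘_; id; case_of_)
open import Relation.Binary.Definitions using (DecidableEquality)
open import Relation.Binary.PropositionalEquality using (_≡_; _≢_; refl; sym; trans; cong; cong₂; subst; subst₂; module ≡-Reasoning)
open import Relation.Nullary using (¬_; Dec; yes; no; contradiction; does)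
open import Relation.Nullary.Decidable using (_→-dec_; decidable-stable; map′; ¬?)
open import Algebra.Properties.CommutativeSemigroup +-commutativeSemigroup using (interchange; x∙yz≈y∙xz)

-- There are m² ordered pairs of edges and M residues, so a bounded number of collisions modulo M is
-- to be expected: too many to exclude, few enough to repair. The repair by digits handles all of
-- them together and needs a large block of vertices that none of the edges involved cuts in two.
-- This is impossible for near pairs, which therefore must not collide at all. That can be afforded
-- because near pairs have at most K m² incidences with vertices, so that few vertices carry many of
-- them.
--
-- In the lower bound the sizes of X and Y balance two costs. A block {c} × 2^Y takes 2^|Y| edges,
-- while the best further edge is only known to settle a 2^-|X| share of the remaining labellings,
-- so that halving them can take 2^|X| such edges. With |X| close to |Y| both costs are about 2^|Y|,
-- whereas the number of subsets of X ⊔ Y is about the square of that: this is the square in m². The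
-- lost logarithmic factors come from the number of halvings and from the number of labels in a sum.

variable
  A B : Set

-- Sums over lists

true-or-false : ∀ b → b ≡ true ⊎ b ≡ false
true-or-false true = inj₁ refl
true-or-false false = inj₂ refl

true≢false : ∀ {b} → b ≡ true → b ≡ false → ⊥
true≢false refl ()

not-true : ∀ {b} → not b ≡ true → b ≡ false
not-true {false} _ = refl

≡ᵇ-sound : ∀ m n → (m ≡ᵇ n) ≡ true → m ≡ n
≡ᵇ-sound m n eq = ≡ᵇ⇒≡ m n (subst T (sym eq) tt)

≡ᵇ-complete : ∀ m n → m ≡ n → (m ≡ᵇ n) ≡ true
≡ᵇ-complete zero .zero refl = refl
≡ᵇ-complete (suc m) .(suc m) refl = ≡ᵇ-complete m m refl

∧-true : ∀ {a b} → a ∧ b ≡ true → a ≡ true × b ≡ true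
∧-true {true} {true} refl = refl , refl

𝟙 : Bool → ℕ
𝟙 true = 1
𝟙 false = 0

𝟙≤1 : ∀ b → 𝟙 b ≤ 1
𝟙≤1 true = ≤-refl
𝟙≤1 false = z≤n

𝟙-mono : ∀ {a b} → (a ≡ true → b ≡ true) → 𝟙 a ≤ 𝟙 b
𝟙-mono {true} imp rewrite imp refl = ≤-refl
𝟙-mono {false} imp = z≤n

∑ : List A → (A → ℕ) → ℕ
∑ [] g = 0
∑ (x ∷ xs) g = g x + ∑ xs g

∑-cong : ∀ (xs : List A) {g h : A → ℕ} → (∀ x → g x ≡ h x) → ∑ xs g ≡ ∑ xs h
∑-cong [] eq = refl
∑-cong (x ∷ xs) eq = cong₂ _+_ (eq x) (∑-cong xs eq)

∑-mono : ∀ (xs : List A) {g h : A → ℕ} → (∀ x → x ∈ xs → g x ≤ h x) → ∑ xs g ≤ ∑ xs h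
∑-mono [] le = z≤n
∑-mono (x ∷ xs) le = +-mono-≤ (le x (here refl)) (∑-mono xs (λ y y∈ → le y (there y∈)))

∑-+ : ∀ (xs : List A) (g h : A → ℕ) → ∑ xs (λ x → g x + h x) ≡ ∑ xs g + ∑ xs h
∑-+ [] g h = refl
∑-+ (x ∷ xs) g h rewrite ∑-+ xs g h = interchange (g x) (h x) (∑ xs g) (∑ xs h)

∑-*ˡ : ∀ (xs : List A) k (g : A → ℕ) → ∑ xs (λ x → k * g x) ≡ k * ∑ xs g
∑-*ˡ [] k g = sym (*-zeroʳ k)
∑-*ˡ (x ∷ xs) k g rewrite ∑-*ˡ xs k g = sym (*-distribˡ-+ k (g x) (∑ xs g))

∑-const : ∀ (xs : List A) k → ∑ xs (λ _ → k) ≡ length xs * k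
∑-const [] k = refl
∑-const (x ∷ xs) k = cong (k +_) (∑-const xs k)

∑-swap : ∀ (xs : List A) (ys : List B) (g : A → B → ℕ) →
  ∑ xs (λ x → ∑ ys (g x)) ≡ ∑ ys (λ y → ∑ xs (λ x → g x y))
∑-swap [] ys g = sym (trans (∑-const ys 0) (*-zeroʳ (length ys)))
∑-swap (x ∷ xs) ys g rewrite ∑-swap xs ys g = sym (∑-+ ys (g x) (λ y → ∑ xs (λ x → g x y)))

∑-++ : ∀ (xs ys : List A) (g : A → ℕ) → ∑ (xs ++ ys) g ≡ ∑ xs g + ∑ ys g
∑-++ [] ys g = refl
∑-++ (x ∷ xs) ys g rewrite ∑-++ xs ys g = sym (+-assoc (g x) (∑ xs g) (∑ ys g))

∑-map : ∀ (f : A → B) (xs : List A) (g : B → ℕ) → ∑ (map f xs) g ≡ ∑ xs (g ∘ f)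
∑-map f [] g = refl
∑-map f (x ∷ xs) g = cong (g (f x) +_) (∑-map f xs g)

∑-cartesianProduct : ∀ (xs : List A) (ys : List B) (g : A × B → ℕ) →
  ∑ (cartesianProduct xs ys) g ≡ ∑ xs (λ x → ∑ ys (λ y → g (x , y)))
∑-cartesianProduct [] ys g = refl
∑-cartesianProduct (x ∷ xs) ys g = begin
  ∑ (map (x ,_) ys ++ cartesianProduct xs ys) g
    ≡⟨ ∑-++ (map (x ,_) ys) (cartesianProduct xs ys) g ⟩
  ∑ (map (x ,_) ys) g + ∑ (cartesianProduct xs ys) g
    ≡⟨ cong₂ _+_ (∑-map (x ,_) ys g) (∑-cartesianProduct xs ys g) ⟩
  ∑ ys (λ y → g (x , y)) + ∑ xs (λ x → ∑ ys (λ y → g (x , y))) ∎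
  where open ≡-Reasoning

length-cartesianProductWith : ∀ {C : Set} (f : A → B → C) xs ys →
  length (cartesianProductWith f xs ys) ≡ length xs * length ys
length-cartesianProductWith f [] ys = refl
length-cartesianProductWith f (x ∷ xs) ys = trans (length-++ (map (f x) ys))
  (cong₂ _+_ (length-map (f x) ys) (length-cartesianProductWith f xs ys))

∑-filter : ∀ (p : A → Bool) xs (g : A → ℕ) →
  ∑ xs g ≡ ∑ (filterᵇ p xs) g + ∑ (filterᵇ (not ∘ p) xs) g
∑-filter p [] g = refl
∑-filter p (x ∷ xs) g with p x
... | true = trans (cong (g x +_) (∑-filter p xs g)) (sym (+-assoc (g x) _ _))
... | false = trans (cong (g x +_) (∑-filter p xs g))
  (x∙yz≈y∙xz (g x) (∑ (filterᵇ p xs) g) (∑ (filterᵇ (not ∘ p) xs) g))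

∑-filter-≤ : ∀ (p : A → Bool) xs (g : A → ℕ) → ∑ (filterᵇ p xs) g ≤ ∑ xs g
∑-filter-≤ p xs g = subst (∑ (filterᵇ p xs) g ≤_) (sym (∑-filter p xs g)) (m≤m+n _ _)

length-filterᵇ : ∀ (p : A → Bool) xs → length (filterᵇ p xs) ≡ ∑ xs (𝟙 ∘ p)
length-filterᵇ p [] = refl
length-filterᵇ p (x ∷ xs) with p x
... | true = cong suc (length-filterᵇ p xs)
... | false = length-filterᵇ p xs

length-filterᵇ-+ : ∀ (p : A → Bool) xs →
  length (filterᵇ p xs) + length (filterᵇ (not ∘ p) xs) ≡ length xs
length-filterᵇ-+ p [] = refl
length-filterᵇ-+ p (x ∷ xs) with p x
... | true = cong suc (length-filterᵇ-+ p xs)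
... | false = trans (+-suc _ _) (cong suc (length-filterᵇ-+ p xs))

∈-filterᵇ⁻ : ∀ (p : A → Bool) xs {x} → x ∈ filterᵇ p xs → x ∈ xs × p x ≡ true
∈-filterᵇ⁻ p (y ∷ xs) x∈ with p y in eq
∈-filterᵇ⁻ p (y ∷ xs) (here refl) | true = here refl , eq
∈-filterᵇ⁻ p (y ∷ xs) (there x∈) | true = let x∈xs , px = ∈-filterᵇ⁻ p xs x∈ in there x∈xs , px
∈-filterᵇ⁻ p (y ∷ xs) x∈ | false = let x∈xs , px = ∈-filterᵇ⁻ p xs x∈ in there x∈xs , px

∈-filterᵇ⁺ : ∀ (p : A → Bool) {xs x} → x ∈ xs → p x ≡ true → x ∈ filterᵇ p xs
∈-filterᵇ⁺ p {y ∷ xs} (here refl) px rewrite px = here refl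
∈-filterᵇ⁺ p {y ∷ xs} (there x∈) px with p y
... | true = there (∈-filterᵇ⁺ p x∈ px)
... | false = ∈-filterᵇ⁺ p x∈ px

any-true⁺ : ∀ (p : A → Bool) {xs x} → x ∈ xs → p x ≡ true → any p xs ≡ true
any-true⁺ p (here refl) px rewrite px = refl
any-true⁺ p {y ∷ xs} (there x∈) px with p y
... | true = refl
... | false = any-true⁺ p x∈ px

any-true⁻ : ∀ (p : A → Bool) xs → any p xs ≡ true → Σ A λ x → x ∈ xs × p x ≡ true
any-true⁻ p (y ∷ xs) eq with p y in py
... | true = y , here refl , py
... | false = let x , x∈ , px = any-true⁻ p xs eq in x , there x∈ , px

any≤∑ : ∀ (p : A → Bool) xs → 𝟙 (any p xs) ≤ ∑ xs (𝟙 ∘ p)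
any≤∑ p [] = z≤n
any≤∑ p (x ∷ xs) with p x
... | true = s≤s z≤n
... | false = any≤∑ p xs

positive-∑ : ∀ (p : A → Bool) xs → 0 < ∑ xs (𝟙 ∘ p) → Σ A λ x → x ∈ xs × p x ≡ true
positive-∑ p (y ∷ xs) pos with p y in py
... | true = y , here refl , py
... | false = let x , x∈ , px = positive-∑ p xs pos in x , there x∈ , px

∑-at-most-one : ∀ (p : A → Bool) xs → Unique xs →
  (∀ {x y} → x ∈ xs → y ∈ xs → p x ≡ true → p y ≡ true → x ≡ y) → ∑ xs (𝟙 ∘ p) ≤ 1
∑-at-most-one p [] u inj = z≤n
∑-at-most-one p (x ∷ xs) (x∉ ∷ u) inj with p x in px
... | false = ∑-at-most-one p xs u (λ x∈ y∈ → inj (there x∈) (there y∈))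
... | true with ∑ xs (𝟙 ∘ p) in eq
...   | zero = ≤-refl
...   | suc _ = let y , y∈ , py = positive-∑ p xs (subst (0 <_) (sym eq) (s≤s z≤n)) in
  contradiction (inj (here refl) (there y∈) px py) (All.lookup x∉ y∈)

∑-at-most-one-any : ∀ (p : A → Bool) xs → ∑ xs (𝟙 ∘ p) ≤ 1 → ∑ xs (𝟙 ∘ p) ≤ 𝟙 (any p xs)
∑-at-most-one-any p [] le = z≤n
∑-at-most-one-any p (x ∷ xs) le with p x
... | true = le
... | false = ∑-at-most-one-any p xs le

below-average : ∀ (xs : List A) (g : A → ℕ) → 0 < length xs →
  Σ A λ x → x ∈ xs × length xs * g x ≤ ∑ xs g
below-average xs g pos = let x , x∈ , x-min = argmin xs pos in
  x , x∈ , subst (_≤ ∑ xs g) (∑-const xs (g x)) (∑-mono xs x-min)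
  where
  argmin : ∀ xs → 0 < length xs → Σ _ λ x → x ∈ xs × (∀ y → y ∈ xs → g x ≤ g y)
  argmin (x ∷ []) _ = x , here refl , λ { y (here refl) → ≤-refl }
  argmin (x ∷ xs@(_ ∷ _)) _ with argmin xs (s≤s z≤n)
  ... | y , y∈ , y-min with ≤-total (g x) (g y)
  ...   | inj₁ gx≤gy = x , here refl ,
    λ { z (here refl) → ≤-refl ; z (there z∈) → ≤-trans gx≤gy (y-min z z∈) }
  ...   | inj₂ gy≤gx = y , there y∈ ,
    λ { z (here refl) → gy≤gx ; z (there z∈) → y-min z z∈ }

above-average : ∀ (xs : List A) (g : A → ℕ) → 0 < length xs →
  Σ A λ x → x ∈ xs × ∑ xs g ≤ length xs * g x
above-average xs g pos = let x , x∈ , x-max = argmax xs pos in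
  x , x∈ , subst (∑ xs g ≤_) (∑-const xs (g x)) (∑-mono xs x-max)
  where
  argmax : ∀ xs → 0 < length xs → Σ _ λ x → x ∈ xs × (∀ y → y ∈ xs → g y ≤ g x)
  argmax (x ∷ []) _ = x , here refl , λ { y (here refl) → ≤-refl }
  argmax (x ∷ xs@(_ ∷ _)) _ with argmax xs (s≤s z≤n)
  ... | y , y∈ , y-max with ≤-total (g y) (g x)
  ...   | inj₁ gy≤gx = x , here refl ,
    λ { z (here refl) → ≤-refl ; z (there z∈) → ≤-trans (y-max z z∈) gy≤gx }
  ...   | inj₂ gx≤gy = y , there y∈ ,
    λ { z (here refl) → gx≤gy ; z (there z∈) → y-max z z∈ }

-- Read from right to left, this inserts a sum over all possible values, after which `∑-swap`
-- regroups a sum over elements by their values.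
∑-downFrom-point : ∀ n x (g : ℕ → ℕ) → x < n → ∑ (downFrom n) (λ y → 𝟙 (x ≡ᵇ y) * g y) ≡ g x
∑-downFrom-point (suc n) x g x<1+n with x ≟ n
... | yes refl = begin
  𝟙 (n ≡ᵇ n) * g n + ∑ (downFrom n) (λ y → 𝟙 (n ≡ᵇ y) * g y)
    ≡⟨ cong₂ _+_ (cong (λ b → 𝟙 b * g n) (≡ᵇ-complete n n refl)) (rest n ≤-refl) ⟩
  1 * g n + 0 ≡⟨ trans (+-identityʳ _) (*-identityˡ (g n)) ⟩
  g n ∎
  where
  open ≡-Reasoning
  rest : ∀ k → k ≤ n → ∑ (downFrom k) (λ y → 𝟙 (n ≡ᵇ y) * g y) ≡ 0
  rest zero _ = refl
  rest (suc k) k<n with n ≡ᵇ k in eq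
  ... | true = contradiction (sym (≡ᵇ-sound n k eq)) (<⇒≢ k<n)
  ... | false = rest k (<⇒≤ k<n)
... | no x≢n with x ≡ᵇ n in eq
...   | true = contradiction (≡ᵇ-sound x n eq) x≢n
...   | false = ∑-downFrom-point n x g (≤∧≢⇒< (≤-pred x<1+n) x≢n)

-- Bits and residues

bit : Bool → ℕ → ℕ
bit b a = if b then a else 0

labelSum-∷ : ∀ {n} x (e : Subset n) f → labelSum (x ∷ e) f ≡ bit x (f zero) + labelSum e (f ∘ suc)
labelSum-∷ true e f = refl
labelSum-∷ false e f = refl

-- Adding `n ∸ m % n` to both sides completes the residue of `m` to `n`, which then vanishes.
%-cancelˡ : ∀ m {x y} n .{{_ : NonZero n}} → (m + x) % n ≡ (m + y) % n → x % n ≡ y % n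
%-cancelˡ m {x} {y} n eq = trans (sym (absorb x)) (trans (cong (λ u → (c + u) % n) eq′) (absorb y))
  where
  open ≡-Reasoning
  c = n ∸ m % n
  eq′ : (m % n + x) % n ≡ (m % n + y) % n
  eq′ = trans (reduce x) (trans eq (sym (reduce y)))
    where
    reduce : ∀ z → (m % n + z) % n ≡ (m + z) % n
    reduce z = begin
      (m % n + z) % n ≡⟨ %-distribˡ-+ (m % n) z n ⟩
      (m % n % n + z % n) % n ≡⟨ cong (λ u → (u + z % n) % n) (m%n%n≡m%n m n) ⟩
      (m % n + z % n) % n ≡⟨ sym (%-distribˡ-+ m z n) ⟩
      (m + z) % n ∎
  absorb : ∀ z → (c + (m % n + z) % n) % n ≡ z % n
  absorb z = begin
    (c + (m % n + z) % n) % n ≡⟨ %-distribˡ-+ c _ n ⟩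
    (c % n + (m % n + z) % n % n) % n ≡⟨ cong (λ u → (c % n + u) % n) (m%n%n≡m%n (m % n + z) n) ⟩
    (c % n + (m % n + z) % n) % n ≡⟨ sym (%-distribˡ-+ c (m % n + z) n) ⟩
    (c + (m % n + z)) % n ≡⟨ cong (_% n) (sym (+-assoc c (m % n) z)) ⟩
    (c + m % n + z) % n ≡⟨ cong (λ u → (u + z) % n) (m∸n+n≡m (m%n≤n m n)) ⟩
    (n + z) % n ≡⟨ cong (_% n) (+-comm n z) ⟩
    (z + n) % n ≡⟨ [m+n]%n≡m%n z n ⟩
    z % n ∎

-- Labels and binary digits

-- To be avoided: αˡ + (sum over eˡ) = αʳ + (sum over eʳ), modulo M or with sums scaled by M.
record Constraint (n : ℕ) : Set where
  constructor mk
  field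
    eˡ eʳ : Subset n
    αˡ αʳ : ℕ
open Constraint

differs : ∀ {n} → Fin n → Constraint n → Bool
differs v c = lookup (eˡ c) v xor lookup (eʳ c) v

degree : ∀ {n} → List (Constraint n) → Fin n → ℕ
degree cs v = ∑ cs (𝟙 ∘ differs v)

-- b marks the vertices whose labels are fixed in advance; only the others can separate.
separated : ∀ {n} → Vec Bool n → Subset n → Subset n → Bool
separated [] [] [] = false
separated (b ∷ bs) (x ∷ e) (y ∷ e′) = (not b ∧ (x xor y)) ∨ separated bs e e′

sep : ∀ {n} → Vec Bool n → Constraint n → Bool
sep b c = separated b (eˡ c) (eʳ c)

collides : ∀ {n} M .{{_ : NonZero M}} → (Fin n → ℕ) → Constraint n → Bool
collides M r c = (αˡ c + labelSum (eˡ c) r) % M ≡ᵇ (αʳ c + labelSum (eʳ c) r) % M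

-- Each near item spoils at most one value, so at least half of the `M` values stay allowed. Over
-- these the far items are hit at most `length far` times in total, and a value that is no worse
-- than the average satisfies the last bound.
avoid-near-spare-far : ∀ {I : Set} (M : ℕ) (bad : I → ℕ → Bool) (near far : List I) → 0 < M →
  (∀ c → c ∈ near → ∑ (downFrom M) (𝟙 ∘ bad c) ≤ 1) →
  (∀ c → c ∈ far → ∑ (downFrom M) (𝟙 ∘ bad c) ≤ 1) →
  2 * length near ≤ M →
  Σ ℕ λ x → x < M × (∀ c → c ∈ near → bad c x ≡ false) ×
    M * ∑ far (λ c → 𝟙 (bad c x)) ≤ 2 * length far
avoid-near-spare-far M bad near far M>0 near≤1 far≤1 2near≤M =
  let x , x∈ , avg = below-average allowed farBad allowed>0
      x∈M , allowedx = ∈-filterᵇ⁻ isAllowed (downFrom M) x∈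
  in x , ∈-downFrom⁻ x∈M , ok x allowedx , (begin
    M * farBad x ≤⟨ *-monoˡ-≤ (farBad x) M≤2allowed ⟩
    2 * length allowed * farBad x ≡⟨ *-assoc 2 (length allowed) (farBad x) ⟩
    2 * (length allowed * farBad x) ≤⟨ *-monoʳ-≤ 2 avg ⟩
    2 * ∑ allowed farBad ≤⟨ *-monoʳ-≤ 2 (∑-filter-≤ isAllowed (downFrom M) farBad) ⟩
    2 * ∑ (downFrom M) farBad ≡⟨ cong (2 *_) (∑-swap (downFrom M) far (λ x c → 𝟙 (bad c x))) ⟩
    2 * ∑ far (λ c → ∑ (downFrom M) (𝟙 ∘ bad c)) ≤⟨ *-monoʳ-≤ 2 (∑-mono far far≤1) ⟩
    2 * ∑ far (λ _ → 1) ≡⟨ cong (2 *_) (trans (∑-const far 1) (*-identityʳ (length far))) ⟩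
    2 * length far ∎)
  where
  open ≤-Reasoning
  farBad : ℕ → ℕ
  farBad x = ∑ far (λ c → 𝟙 (bad c x))
  hit isAllowed : ℕ → Bool
  hit x = any (λ c → bad c x) near
  isAllowed x = not (hit x)
  allowed = filterᵇ isAllowed (downFrom M)
  farNear : ℕ → ℕ
  farNear x = ∑ near (λ c → 𝟙 (bad c x))
  hits≤ : length (filterᵇ hit (downFrom M)) ≤ length near
  hits≤ = begin
    length (filterᵇ hit (downFrom M)) ≡⟨ length-filterᵇ hit (downFrom M) ⟩
    ∑ (downFrom M) (𝟙 ∘ hit) ≤⟨ ∑-mono (downFrom M) {𝟙 ∘ hit} {farNear} (λ x _ → any≤∑ (λ c → bad c x) near) ⟩
    ∑ (downFrom M) farNear ≡⟨ ∑-swap (downFrom M) near (λ x c → 𝟙 (bad c x)) ⟩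
    ∑ near (λ c → ∑ (downFrom M) (𝟙 ∘ bad c)) ≤⟨ ∑-mono near near≤1 ⟩
    ∑ near (λ _ → 1) ≡⟨ trans (∑-const near 1) (*-identityʳ (length near)) ⟩
    length near ∎
  M≤2allowed : M ≤ 2 * length allowed
  M≤2allowed = +-cancelʳ-≤ M _ _ (begin
    M + M ≡⟨ cong (M +_) (sym (+-identityʳ M)) ⟩
    2 * M ≡⟨ cong (2 *_) (sym (trans (length-filterᵇ-+ hit (downFrom M)) (length-downFrom M))) ⟩
    2 * (length (filterᵇ hit (downFrom M)) + length allowed) ≤⟨ *-monoʳ-≤ 2 (+-monoˡ-≤ (length allowed) hits≤) ⟩
    2 * (length near + length allowed) ≡⟨ *-distribˡ-+ 2 (length near) (length allowed) ⟩
    2 * length near + 2 * length allowed ≤⟨ +-monoˡ-≤ _ 2near≤M ⟩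
    M + 2 * length allowed ≡⟨ +-comm M _ ⟩
    2 * length allowed + M ∎)
  allowed>0 : 0 < length allowed
  allowed>0 = n≢0⇒n>0 λ eq → <⇒≱ M>0 (subst (λ u → M ≤ 2 * u) eq M≤2allowed)
  ok : ∀ x → isAllowed x ≡ true → ∀ c → c ∈ near → bad c x ≡ false
  ok x allowedx c c∈ with bad c x in eq
  ... | false = refl
  ... | true with hit x | any-true⁺ (λ c → bad c x) c∈ eq
  ok x () c c∈ | true | true | refl

-- Meant for a first vertex in both edges or in neither: its label shifts both sides equally, so the
-- constraint can be passed on before that label is chosen.
dropHead : ∀ {n} → Constraint (suc n) → Constraint n
dropHead c = mk (tail (eˡ c)) (tail (eʳ c)) (αˡ c) (αʳ c)

-- A label known in advance moves into the constants; this is why constraints carry `αˡ` and `αʳ`.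
fixHead : ∀ {n} → ℕ → Constraint (suc n) → Constraint n
fixHead w c = mk (tail (eˡ c)) (tail (eʳ c)) (αˡ c + bit (head (eˡ c)) w) (αʳ c + bit (head (eʳ c)) w)

sep-fixed : ∀ {n} (b : Vec Bool n) w c → sep (true ∷ b) c ≡ sep b (fixHead w c)
sep-fixed b w (mk (x ∷ e) (y ∷ e′) _ _) = refl

sep-same : ∀ {n} (b : Vec Bool n) c → not (differs zero c) ≡ true → sep (false ∷ b) c ≡ sep b (dropHead c)
sep-same b (mk (x ∷ e) (y ∷ e′) _ _) same with x xor y
sep-same b (mk (x ∷ e) (y ∷ e′) _ _) refl | false = refl

differs-tail : ∀ {n} (v : Fin n) c → differs v (dropHead c) ≡ differs (suc v) c
differs-tail v (mk (x ∷ e) (y ∷ e′) _ _) = refl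

module _ {n : ℕ} (M : ℕ) .{{_ : NonZero M}} where

  collides-fixed : ∀ w r (c : Constraint (suc n)) → collides M (w ▹ r) c ≡ collides M r (fixHead w c)
  collides-fixed w r (mk (x ∷ e) (y ∷ e′) α β) =
    cong₂ (λ s t → s % M ≡ᵇ t % M) (move α x e) (move β y e′)
    where
    move : ∀ α x e → α + labelSum (x ∷ e) (w ▹ r) ≡ α + bit x w + labelSum e r
    move α x e = trans (cong (α +_) (labelSum-∷ x e (w ▹ r))) (sym (+-assoc α (bit x w) _))

  collides-same : ∀ w r (c : Constraint (suc n)) → not (differs zero c) ≡ true →
    collides M (w ▹ r) c ≡ true → collides M r (dropHead c) ≡ true
  collides-same w r (mk (x ∷ e) (y ∷ e′) α β) same col =
    ≡ᵇ-complete _ _ (%-cancelˡ (bit x w) M (begin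
      (bit x w + (α + labelSum e r)) % M ≡⟨ cong (_% M) (sym (move α x e)) ⟩
      (α + labelSum (x ∷ e) (w ▹ r)) % M ≡⟨ ≡ᵇ-sound _ _ col ⟩
      (β + labelSum (y ∷ e′) (w ▹ r)) % M ≡⟨ cong (_% M) (move β y e′) ⟩
      (bit y w + (β + labelSum e′ r)) % M ≡⟨ cong (λ z → (bit z w + (β + labelSum e′ r)) % M) (sym (x≡y x y same)) ⟩
      (bit x w + (β + labelSum e′ r)) % M ∎))
    where
    open ≡-Reasoning
    x≡y : ∀ x y → not (x xor y) ≡ true → x ≡ y
    x≡y true true _ = refl
    x≡y false false _ = refl
    move : ∀ α x e → α + labelSum (x ∷ e) (w ▹ r) ≡ bit x w + (α + labelSum e r)
    move α x e = trans (cong (α +_) (labelSum-∷ x e (w ▹ r))) (x∙yz≈y∙xz α (bit x w) (labelSum e r))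

  suc-%-injective : ∀ P {i j} → i < M → j < M → (P + suc i) % M ≡ (P + suc j) % M → i ≡ j
  suc-%-injective P {i} {j} i<M j<M eq = begin
    i ≡⟨ sym (m<n⇒m%n≡m i<M) ⟩
    i % M ≡⟨ %-cancelˡ 1 M (%-cancelˡ P M eq) ⟩
    j % M ≡⟨ m<n⇒m%n≡m j<M ⟩
    j ∎
    where open ≡-Reasoning

  -- The label occurs on one side only, and the labels `suc i` with `i < M` run through every
  -- residue once.
  collides-at-most-once : ∀ r (c : Constraint (suc n)) → differs zero c ≡ true →
    ∑ (downFrom M) (λ i → 𝟙 (collides M (suc i ▹ r) c)) ≤ 1
  collides-at-most-once r c diff = ∑-at-most-one _ _ (downFrom⁺ M)
    (λ i∈ j∈ ci cj → inj c diff (∈-downFrom⁻ i∈) (∈-downFrom⁻ j∈) (≡ᵇ-sound _ _ ci) (≡ᵇ-sound _ _ cj))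
    where
    move : ∀ a b c → a + (b + c) ≡ a + c + b
    move = solve-∀
    inj : ∀ c → differs zero c ≡ true → ∀ {i j} → i < M → j < M →
      (αˡ c + labelSum (eˡ c) (suc i ▹ r)) % M ≡ (αʳ c + labelSum (eʳ c) (suc i ▹ r)) % M →
      (αˡ c + labelSum (eˡ c) (suc j ▹ r)) % M ≡ (αʳ c + labelSum (eʳ c) (suc j ▹ r)) % M → i ≡ j
    inj (mk (true ∷ e) (false ∷ e′) α β) _ {i} {j} i<M j<M eqᵢ eqⱼ =
      suc-%-injective (α + labelSum e r) i<M j<M (trans (cong (_% M) (sym (move α (suc i) _)))
        (trans (trans eqᵢ (sym eqⱼ)) (cong (_% M) (move α (suc j) _))))
    inj (mk (false ∷ e) (true ∷ e′) α β) _ {i} {j} i<M j<M eqᵢ eqⱼ =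
      suc-%-injective (β + labelSum e′ r) i<M j<M (trans (cong (_% M) (sym (move β (suc i) _)))
        (trans (trans (sym eqᵢ) eqⱼ) (cong (_% M) (move β (suc j) _))))

-- Both collision bounds concern only pairs separated by a free vertex. Pairs that differ on fixed
-- vertices alone are left to the powers of two placed there.
GreedyLabelling : ∀ {n} M .{{_ : NonZero M}} (b : Vec Bool n) (g : Fin n → ℕ) (near far : List (Constraint n)) → Set
GreedyLabelling {n} M b g near far = Σ (Fin n → ℕ) λ r →
  (∀ v → lookup b v ≡ true → r v ≡ g v) ×
  (∀ v → lookup b v ≡ false → 1 ≤ r v × r v ≤ M) ×
  (∀ c → c ∈ near → sep b c ≡ true → collides M r c ≡ false) ×
  M * ∑ far (λ c → 𝟙 (sep b c ∧ collides M r c)) ≤ 2 * length far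

module _ {n : ℕ} (M : ℕ) .{{_ : NonZero M}} (b : Vec Bool n) (g : Fin (suc n) → ℕ) (near far : List (Constraint (suc n))) where

  private
    w = g zero
    same : Constraint (suc n) → Bool
    same = not ∘ differs zero
    far₁ = filterᵇ (differs zero) far
    far₀ = filterᵇ same far

  extend-fixed : GreedyLabelling M b (g ∘ suc) (map (fixHead w) near) (map (fixHead w) far) →
    GreedyLabelling M (true ∷ b) g near far
  extend-fixed (r , fixed , bounds , near-ok , far-ok) = w ▹ r ,
    (λ { zero _ → refl ; (suc v) bv → fixed v bv }) ,
    (λ { zero () ; (suc v) bv → bounds v bv }) ,
    (λ c c∈ s → trans (collides-fixed M w r c)
      (near-ok (fixHead w c) (∈-map⁺ (fixHead w) c∈) (trans (sym (sep-fixed b w c)) s))) ,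
    far-all
    where
    open ≤-Reasoning
    hit : Constraint (suc n) → ℕ
    hit c = 𝟙 (sep (true ∷ b) c ∧ collides M (w ▹ r) c)
    hit₀ : Constraint n → ℕ
    hit₀ c = 𝟙 (sep b c ∧ collides M r c)
    hit≡ : ∀ c → hit c ≡ hit₀ (fixHead w c)
    hit≡ c = cong 𝟙 (cong₂ _∧_ (sep-fixed b w c) (collides-fixed M w r c))
    far-all : M * ∑ far hit ≤ 2 * length far
    far-all = begin
      M * ∑ far hit ≡⟨ cong (M *_) (∑-cong far hit≡) ⟩
      M * ∑ far (hit₀ ∘ fixHead w) ≡⟨ cong (M *_) (sym (∑-map (fixHead w) far hit₀)) ⟩
      M * ∑ (map (fixHead w) far) hit₀ ≤⟨ far-ok ⟩
      2 * length (map (fixHead w) far) ≡⟨ cong (2 *_) (length-map (fixHead w) far) ⟩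
      2 * length far ∎

  -- The later labels `r` are already known, so a constraint that differs at the first vertex is
  -- decided by its label, and all others are decided by `r`. Hence every far constraint is charged
  -- at most once, at the first free vertex where its edges differ, and the two budgets add up to
  -- `2 * length far`.
  extend-free : 2 * degree near zero ≤ M →
    GreedyLabelling M b (g ∘ suc) (map dropHead (filterᵇ same near)) (map dropHead (filterᵇ same far)) →
    GreedyLabelling M (false ∷ b) g near far
  extend-free deg (r , fixed , bounds , near-ok , far-ok) =
    let i , i<M , near-ok₁ , far-ok₁ = choice in suc i ▹ r ,
    (λ { zero () ; (suc v) bv → fixed v bv }) ,
    (λ { zero _ → s≤s z≤n , i<M ; (suc v) bv → bounds v bv }) ,
    near-all i near-ok₁ , far-all i far-ok₁
    where
    open ≤-Reasoning
    bad : Constraint (suc n) → ℕ → Bool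
    bad c i = collides M (suc i ▹ r) c
    near₁ = filterᵇ (differs zero) near
    atMost : ∀ cs c → c ∈ filterᵇ (differs zero) cs → ∑ (downFrom M) (𝟙 ∘ bad c) ≤ 1
    atMost cs c c∈ = collides-at-most-once M r c (proj₂ (∈-filterᵇ⁻ (differs zero) cs c∈))
    choice = avoid-near-spare-far M bad near₁ far₁ (>-nonZero⁻¹ M) (atMost near) (atMost far)
      (subst (λ d → 2 * d ≤ M) (sym (length-filterᵇ (differs zero) near)) deg)
    hit₀ : Constraint n → ℕ
    hit₀ c = 𝟙 (sep b c ∧ collides M r c)
    module _ (i : ℕ) where
      near-all : (∀ c → c ∈ near₁ → bad c i ≡ false) →
        ∀ c → c ∈ near → sep (false ∷ b) c ≡ true → bad c i ≡ false
      near-all near-ok₁ c c∈ s with true-or-false (differs zero c) | true-or-false (bad c i)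
      ... | inj₁ d | _ = near-ok₁ c (∈-filterᵇ⁺ (differs zero) c∈ d)
      ... | inj₂ d | inj₂ ok = ok
      ... | inj₂ d | inj₁ col = ⊥-elim (true≢false (collides-same M (suc i) r c (cong not d) col)
        (near-ok (dropHead c) (∈-map⁺ dropHead (∈-filterᵇ⁺ same c∈ (cong not d)))
          (trans (sym (sep-same b c (cong not d))) s)))
      hit : Constraint (suc n) → ℕ
      hit c = 𝟙 (sep (false ∷ b) c ∧ bad c i)
      badᵢ : Constraint (suc n) → ℕ
      badᵢ c = 𝟙 (bad c i)
      hit-diff : ∀ c → hit c ≤ badᵢ c
      hit-diff c = 𝟙-mono (λ eq → proj₂ (∧-true {sep (false ∷ b) c} eq))
      hit-same : ∀ c → c ∈ far₀ → hit c ≤ hit₀ (dropHead c)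
      hit-same c c∈ = let sm = proj₂ (∈-filterᵇ⁻ same far c∈) in 𝟙-mono λ eq →
        let s , col = ∧-true {sep (false ∷ b) c} eq in
        cong₂ _∧_ (trans (sym (sep-same b c sm)) s) (collides-same M (suc i) r c sm col)
      far-all : M * ∑ far₁ badᵢ ≤ 2 * length far₁ → M * ∑ far hit ≤ 2 * length far
      far-all far-ok₁ = begin
        M * ∑ far hit ≡⟨ cong (M *_) (∑-filter (differs zero) far hit) ⟩
        M * (∑ far₁ hit + ∑ far₀ hit)
          ≤⟨ *-monoʳ-≤ M (+-mono-≤ (∑-mono far₁ (λ c _ → hit-diff c)) (∑-mono far₀ hit-same)) ⟩
        M * (∑ far₁ badᵢ + ∑ far₀ (hit₀ ∘ dropHead)) ≡⟨ *-distribˡ-+ M (∑ far₁ badᵢ) _ ⟩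
        M * ∑ far₁ badᵢ + M * ∑ far₀ (hit₀ ∘ dropHead)
          ≡⟨ cong (λ s → M * ∑ far₁ badᵢ + M * s) (sym (∑-map dropHead far₀ hit₀)) ⟩
        M * ∑ far₁ badᵢ + M * ∑ (map dropHead far₀) hit₀ ≤⟨ +-mono-≤ far-ok₁ far-ok ⟩
        2 * length far₁ + 2 * length (map dropHead far₀)
          ≡⟨ cong (λ l → 2 * length far₁ + 2 * l) (length-map dropHead far₀) ⟩
        2 * length far₁ + 2 * length far₀ ≡⟨ sym (*-distribˡ-+ 2 (length far₁) (length far₀)) ⟩
        2 * (length far₁ + length far₀) ≡⟨ cong (2 *_) (length-filterᵇ-+ (differs zero) far) ⟩
        2 * length far ∎

-- Vertices are labelled from the last to the first; a label for the current vertex must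
-- avoid the residues forced by the near constraints decided there, and among the remaining
-- ones some label causes at most about an average number of far collisions.
greedy : ∀ {n} M .{{_ : NonZero M}} (b : Vec Bool n) (g : Fin n → ℕ) (near far : List (Constraint n)) →
  (∀ v → lookup b v ≡ false → 2 * degree near v ≤ M) → GreedyLabelling M b g near far
greedy M [] g near far deg = (λ ()) , (λ ()) , (λ ()) , (λ { (mk [] [] _ _) _ () }) ,
  subst (_≤ 2 * length far) (sym (trans (cong (M *_) (none far)) (*-zeroʳ M))) z≤n
  where
  none : ∀ cs → ∑ cs (λ c → 𝟙 (sep [] c ∧ collides M (λ ()) c)) ≡ 0
  none [] = refl
  none (mk [] [] _ _ ∷ cs) = none cs
greedy M (true ∷ b) g near far deg = extend-fixed M b g near far
  (greedy M b (g ∘ suc) (map (fixHead (g zero)) near) (map (fixHead (g zero)) far)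
    (λ v bv → subst (λ d → 2 * d ≤ M) (sym (degree-tail near v)) (deg (suc v) bv)))
  where
  degree-tail : ∀ cs v → degree (map (fixHead (g zero)) cs) v ≡ degree cs (suc v)
  degree-tail cs v = trans (∑-map (fixHead (g zero)) cs _) (∑-cong cs (λ c → cong 𝟙 (differs-tail v c)))
greedy M (false ∷ b) g near far deg = extend-free M b g near far (deg zero refl)
  (greedy M b (g ∘ suc) (map dropHead (filterᵇ same near)) (map dropHead (filterᵇ same far))
    (λ v bv → ≤-trans (*-monoʳ-≤ 2 (degree-tail near v)) (deg (suc v) bv)))
  where
  same : Constraint _ → Bool
  same = not ∘ differs zero
  degree-tail : ∀ cs v → degree (map dropHead (filterᵇ same cs)) v ≤ degree cs (suc v)
  degree-tail cs v = subst (_≤ degree cs (suc v))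
    (sym (trans (∑-map dropHead (filterᵇ same cs) _) (∑-cong (filterᵇ same cs) (λ c → cong 𝟙 (differs-tail v c)))))
    (∑-filter-≤ same cs (𝟙 ∘ differs (suc v)))

-- Vertices in many near pairs, and binary codes on them

size : ∀ {n} → Vec Bool n → ℕ
size [] = 0
size (b ∷ bs) = 𝟙 b + size bs

dist : ∀ {n} → Subset n → Subset n → ℕ
dist e e′ = size (zipWith _xor_ e e′)

∑ᶠ : ∀ n → (Fin n → ℕ) → ℕ
∑ᶠ zero g = 0
∑ᶠ (suc n) g = g zero + ∑ᶠ n (g ∘ suc)

∑ᶠ-cong : ∀ n {g h : Fin n → ℕ} → (∀ v → g v ≡ h v) → ∑ᶠ n g ≡ ∑ᶠ n h
∑ᶠ-cong zero eq = refl
∑ᶠ-cong (suc n) eq = cong₂ _+_ (eq zero) (∑ᶠ-cong n (eq ∘ suc))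

∑ᶠ-swap : ∀ n (xs : List A) (g : Fin n → A → ℕ) → ∑ᶠ n (λ v → ∑ xs (g v)) ≡ ∑ xs (λ x → ∑ᶠ n (λ v → g v x))
∑ᶠ-swap zero xs g = sym (trans (∑-const xs 0) (*-zeroʳ (length xs)))
∑ᶠ-swap (suc n) xs g rewrite ∑ᶠ-swap n xs (g ∘ suc) = sym (∑-+ xs (g zero) (λ x → ∑ᶠ n (λ v → g (suc v) x)))

∑ᶠ-differs : ∀ {n} (e e′ : Subset n) → ∑ᶠ n (λ v → 𝟙 (lookup e v xor lookup e′ v)) ≡ dist e e′
∑ᶠ-differs [] [] = refl
∑ᶠ-differs (x ∷ e) (y ∷ e′) = cong (𝟙 (x xor y) +_) (∑ᶠ-differs e e′)

∑ᶠ-degree : ∀ {n} (cs : List (Constraint n)) → ∑ᶠ n (degree cs) ≡ ∑ cs (λ c → dist (eˡ c) (eʳ c))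
∑ᶠ-degree {n} cs = trans (∑ᶠ-swap n cs (λ v c → 𝟙 (differs v c))) (∑-cong cs (λ c → ∑ᶠ-differs (eˡ c) (eʳ c)))

markov : ∀ n M (d : Fin n → ℕ) → size (tabulate (λ v → M <ᵇ 2 * d v)) * M ≤ 2 * ∑ᶠ n d
markov zero M d = z≤n
markov (suc n) M d = begin
  (𝟙 (M <ᵇ 2 * d zero) + rest) * M ≡⟨ *-distribʳ-+ M (𝟙 (M <ᵇ 2 * d zero)) rest ⟩
  𝟙 (M <ᵇ 2 * d zero) * M + rest * M ≤⟨ +-mono-≤ first (markov n M (d ∘ suc)) ⟩
  2 * d zero + 2 * ∑ᶠ n (d ∘ suc) ≡⟨ sym (*-distribˡ-+ 2 (d zero) _) ⟩
  2 * (d zero + ∑ᶠ n (d ∘ suc)) ∎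
  where
  open ≤-Reasoning
  rest = size (tabulate (λ v → M <ᵇ 2 * d (suc v)))
  first : 𝟙 (M <ᵇ 2 * d zero) * M ≤ 2 * d zero
  first with M <ᵇ 2 * d zero in eq
  ... | true = subst (_≤ 2 * d zero) (sym (*-identityˡ M)) (<⇒≤ (<ᵇ⇒< M (2 * d zero) (subst T (sym eq) _)))
  ... | false = z≤n

-- The exponent counts the marked positions further on, so the marked vertices, read from the last,
-- receive 1, 2, 4 and so on.
powers : ∀ {n} → Vec Bool n → Fin n → ℕ
powers (b ∷ bs) zero = 2 ^ size bs
powers (b ∷ bs) (suc v) = powers bs v

powers-bounds : ∀ {n} (b : Vec Bool n) v → 1 ≤ powers b v × powers b v ≤ 2 ^ size b
powers-bounds (b ∷ bs) zero = m^n>0 2 (size bs) , ^-monoʳ-≤ 2 (m≤n+m (size bs) (𝟙 b))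
powers-bounds (b ∷ bs) (suc v) = let l , u = powers-bounds bs v in
  l , ≤-trans u (^-monoʳ-≤ 2 (m≤n+m (size bs) (𝟙 b)))

-- The part of a sum of labels that comes from b, read as a binary number.
code : ∀ {n} → Vec Bool n → Subset n → ℕ
code [] [] = 0
code (b ∷ bs) (x ∷ e) = bit (b ∧ x) (2 ^ size bs) + code bs e

code< : ∀ {n} (b : Vec Bool n) e → code b e < 2 ^ size b
code< [] [] = s≤s z≤n
code< (true ∷ b) (true ∷ e) = subst (2 ^ size b + code b e <_)
  (cong (2 ^ size b +_) (sym (+-identityʳ (2 ^ size b)))) (+-monoʳ-< (2 ^ size b) (code< b e))
code< (true ∷ b) (false ∷ e) = <-≤-trans (code< b e) (m≤m+n (2 ^ size b) _)
code< (false ∷ b) (x ∷ e) = code< b e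

-- Uniqueness of binary expansions: by `code<` a marked bit outweighs all later ones. At unmarked
-- positions the edges agree because nothing there separates them.
code-injective : ∀ {n} (b : Vec Bool n) e e′ → separated b e e′ ≡ false → code b e ≡ code b e′ → e ≡ e′
code-injective [] [] [] _ _ = refl
code-injective (true ∷ b) (true ∷ e) (true ∷ e′) s eq =
  cong (true ∷_) (code-injective b e e′ s (+-cancelˡ-≡ (2 ^ size b) _ _ eq))
code-injective (true ∷ b) (true ∷ e) (false ∷ e′) s eq =
  contradiction (≤-trans (m≤m+n (2 ^ size b) (code b e)) (≤-reflexive eq)) (<⇒≱ (code< b e′))
code-injective (true ∷ b) (false ∷ e) (true ∷ e′) s eq =
  contradiction (≤-trans (m≤m+n (2 ^ size b) (code b e′)) (≤-reflexive (sym eq))) (<⇒≱ (code< b e))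
code-injective (true ∷ b) (false ∷ e) (false ∷ e′) s eq = cong (false ∷_) (code-injective b e e′ s eq)
code-injective (false ∷ b) (true ∷ e) (true ∷ e′) s eq = cong (true ∷_) (code-injective b e e′ s eq)
code-injective (false ∷ b) (false ∷ e) (false ∷ e′) s eq = cong (false ∷_) (code-injective b e e′ s eq)

-- The common offset `o` is the sum over the unmarked vertices, where the two edges coincide.
labelSum-code : ∀ {n} (b : Vec Bool n) (r : Fin n → ℕ) → (∀ v → lookup b v ≡ true → r v ≡ powers b v) →
  ∀ e e′ → separated b e e′ ≡ false →
  Σ ℕ λ o → labelSum e r ≡ o + code b e × labelSum e′ r ≡ o + code b e′
labelSum-code [] r fixed [] [] _ = 0 , refl , refl
labelSum-code (true ∷ b) r fixed (x ∷ e) (y ∷ e′) s =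
  let o , eq , eq′ = labelSum-code b (r ∘ suc) (fixed ∘ suc) e e′ s in
  o , step o x e eq , step o y e′ eq′
  where
  step : ∀ o x e → labelSum e (r ∘ suc) ≡ o + code b e →
    labelSum (x ∷ e) r ≡ o + (bit x (2 ^ size b) + code b e)
  step o x e eq = trans (labelSum-∷ x e r) (trans (cong₂ (λ u v → bit x u + v) (fixed zero refl) eq)
    (x∙yz≈y∙xz (bit x (2 ^ size b)) o (code b e)))
labelSum-code (false ∷ b) r fixed (true ∷ e) (true ∷ e′) s =
  let o , eq , eq′ = labelSum-code b (r ∘ suc) (fixed ∘ suc) e e′ s in
  r zero + o , trans (cong (r zero +_) eq) (sym (+-assoc (r zero) o _)) ,
    trans (cong (r zero +_) eq′) (sym (+-assoc (r zero) o _))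
labelSum-code (false ∷ b) r fixed (false ∷ e) (false ∷ e′) s = labelSum-code b (r ∘ suc) (fixed ∘ suc) e e′ s

-- Once the common offset is cancelled, both codes lie below `2 ^ size b ≤ M`, so congruent codes
-- are equal.
unseparated-distinct : ∀ {n} M .{{_ : NonZero M}} (b : Vec Bool n) (r : Fin n → ℕ) →
  (∀ v → lookup b v ≡ true → r v ≡ powers b v) → 2 ^ size b ≤ M →
  ∀ e e′ → separated b e e′ ≡ false → labelSum e r % M ≡ labelSum e′ r % M → e ≡ e′
unseparated-distinct M b r fixed 2^≤M e e′ s eq =
  let o , le , le′ = labelSum-code b r fixed e e′ s
      eq% = %-cancelˡ o M (trans (cong (_% M) (sym le)) (trans eq (cong (_% M) le′)))
  in code-injective b e e′ s (trans (sym (small e)) (trans eq% (small e′)))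
  where
  small : ∀ e → code b e % M ≡ code b e
  small e = m<n⇒m%n≡m (<-≤-trans (code< b e) 2^≤M)

-- Separating far pairs by digits

ConstantOn : ∀ {n} → Vec Bool n → Subset n → Set
ConstantOn Y s = Σ Bool λ χ → ∀ v → lookup Y v ≡ true → lookup s v ≡ χ

_∧⟨_⟩_ : ∀ {n} → Vec Bool n → (Bool → Bool) → Vec Bool n → Vec Bool n
X ∧⟨ f ⟩ s = zipWith (λ x y → x ∧ f y) X s

size-split : ∀ {n} (X s : Vec Bool n) → size (X ∧⟨ id ⟩ s) + size (X ∧⟨ not ⟩ s) ≡ size X
size-split [] [] = refl
size-split (x ∷ X) (y ∷ s) = trans (interchange (𝟙 (x ∧ y)) (size (X ∧⟨ id ⟩ s)) (𝟙 (x ∧ not y)) (size (X ∧⟨ not ⟩ s)))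
  (cong₂ _+_ (one x y) (size-split X s))
  where
  one : ∀ x y → 𝟙 (x ∧ y) + 𝟙 (x ∧ not y) ≡ 𝟙 x
  one true true = refl
  one true false = refl
  one false _ = refl

lookup-∧ : ∀ {n} f (X s : Vec Bool n) v → lookup (X ∧⟨ f ⟩ s) v ≡ true → lookup X v ≡ true × f (lookup s v) ≡ true
lookup-∧ f (x ∷ X) (y ∷ s) zero eq = ∧-true eq
lookup-∧ f (x ∷ X) (y ∷ s) (suc v) eq = lookup-∧ f X s v eq

-- Pigeonhole: for each set in `ss`, keep the part of `X` inside it or the part outside it,
-- whichever is large enough. Each set costs a factor of two.
homogeneous : ∀ {n} (ss : List (Vec Bool n)) (X : Vec Bool n) q → 2 ^ length ss * q ≤ size X →
  Σ (Vec Bool n) λ Y → (∀ v → lookup Y v ≡ true → lookup X v ≡ true) × q ≤ size Y ×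
    (∀ s → s ∈ ss → ConstantOn Y s)
homogeneous [] X q large = X , (λ _ eq → eq) , subst (_≤ size X) (*-identityˡ q) large , λ _ ()
homogeneous (s ∷ ss) X q large with 2 ^ length ss * q ≤? size (X ∧⟨ id ⟩ s)
... | yes large₁ = let Y , Y⊆ , q≤ , const = homogeneous ss (X ∧⟨ id ⟩ s) q large₁ in
  Y , (λ v eq → proj₁ (lookup-∧ id X s v (Y⊆ v eq))) , q≤ ,
  λ { t (here refl) → true , λ v eq → proj₂ (lookup-∧ id X s v (Y⊆ v eq)) ; t (there t∈) → const t t∈ }
... | no small₁ = let Y , Y⊆ , q≤ , const = homogeneous ss (X ∧⟨ not ⟩ s) q large₀ in
  Y , (λ v eq → proj₁ (lookup-∧ not X s v (Y⊆ v eq))) , q≤ ,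
  λ { t (here refl) → false , λ v eq → not-true (proj₂ (lookup-∧ not X s v (Y⊆ v eq))) ; t (there t∈) → const t t∈ }
  where
  open ≤-Reasoning
  u = 2 ^ length ss * q
  double : ∀ a q → 2 * a * q ≡ a * q + a * q
  double = solve-∀
  large₀ : u ≤ size (X ∧⟨ not ⟩ s)
  large₀ = +-cancelˡ-≤ u _ _ (begin
    u + u ≡⟨ sym (double (2 ^ length ss) q) ⟩
    2 ^ length (s ∷ ss) * q ≤⟨ large ⟩
    size X ≡⟨ sym (size-split X s) ⟩
    size (X ∧⟨ id ⟩ s) + size (X ∧⟨ not ⟩ s) ≤⟨ +-monoˡ-≤ _ (<⇒≤ (≰⇒> small₁)) ⟩
    u + size (X ∧⟨ not ⟩ s) ∎)

-- The relevant edges contain all of `Y` or none of it, so only the number of ones on `Y` matters;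
-- they are simply placed at the front.
setOn : ∀ {n} → Vec Bool n → ℕ → (Fin n → ℕ) → Fin n → ℕ
setOn (true ∷ Y) (suc x) z zero = 1
setOn (true ∷ Y) zero z zero = 0
setOn (true ∷ Y) (suc x) z (suc v) = setOn Y x (z ∘ suc) v
setOn (true ∷ Y) zero z (suc v) = setOn Y zero (z ∘ suc) v
setOn (false ∷ Y) x z zero = z zero
setOn (false ∷ Y) x z (suc v) = setOn Y x (z ∘ suc) v

setOn≤1 : ∀ {n} (Y : Vec Bool n) x z → (∀ v → z v ≤ 1) → ∀ v → setOn Y x z v ≤ 1
setOn≤1 (true ∷ Y) (suc x) z le zero = ≤-refl
setOn≤1 (true ∷ Y) zero z le zero = z≤n
setOn≤1 (true ∷ Y) (suc x) z le (suc v) = setOn≤1 Y x (z ∘ suc) (le ∘ suc) v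
setOn≤1 (true ∷ Y) zero z le (suc v) = setOn≤1 Y zero (z ∘ suc) (le ∘ suc) v
setOn≤1 (false ∷ Y) x z le zero = le zero
setOn≤1 (false ∷ Y) x z le (suc v) = setOn≤1 Y x (z ∘ suc) (le ∘ suc) v

off : ∀ {n} → Vec Bool n → Subset n → Subset n
off Y s = s ∧⟨ not ⟩ Y

labelSum-setOn : ∀ {n} (Y : Vec Bool n) s χ x z → (∀ v → lookup Y v ≡ true → lookup s v ≡ χ) → x ≤ size Y →
  labelSum s (setOn Y x z) ≡ labelSum (off Y s) z + bit χ x
labelSum-setOn [] [] true zero z const _ = refl
labelSum-setOn [] [] false x z const _ = refl
labelSum-setOn (true ∷ Y) (y ∷ s) χ x z const x≤ with const zero refl
labelSum-setOn (true ∷ Y) (true ∷ s) .true zero z const x≤ | refl =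
  labelSum-setOn Y s true zero (z ∘ suc) (const ∘ suc) z≤n
labelSum-setOn (true ∷ Y) (true ∷ s) .true (suc x) z const (s≤s x≤) | refl =
  trans (cong suc (labelSum-setOn Y s true x (z ∘ suc) (const ∘ suc) x≤)) (sym (+-suc _ x))
labelSum-setOn (true ∷ Y) (false ∷ s) .false zero z const x≤ | refl =
  labelSum-setOn Y s false zero (z ∘ suc) (const ∘ suc) z≤n
labelSum-setOn (true ∷ Y) (false ∷ s) .false (suc x) z const (s≤s x≤) | refl =
  labelSum-setOn Y s false x (z ∘ suc) (const ∘ suc) x≤
labelSum-setOn (false ∷ Y) (true ∷ s) χ x z const x≤ =
  trans (cong (z zero +_) (labelSum-setOn Y s χ x (z ∘ suc) (const ∘ suc) x≤)) (sym (+-assoc (z zero) _ _))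
labelSum-setOn (false ∷ Y) (false ∷ s) χ x z const x≤ = labelSum-setOn Y s χ x (z ∘ suc) (const ∘ suc) x≤

labelSum-off : ∀ {n} (Y : Vec Bool n) s χ z → (∀ v → lookup Y v ≡ true → lookup s v ≡ χ) →
  labelSum s z ≡ labelSum (off Y s) z + bit χ (labelSum Y z)
labelSum-off [] [] true z const = refl
labelSum-off [] [] false z const = refl
labelSum-off (true ∷ Y) (y ∷ s) χ z const with const zero refl
labelSum-off (true ∷ Y) (true ∷ s) .true z const | refl =
  trans (cong (z zero +_) (labelSum-off Y s true (z ∘ suc) (const ∘ suc))) (x∙yz≈y∙xz (z zero) (labelSum (off Y s) (z ∘ suc)) (labelSum Y (z ∘ suc)))
labelSum-off (true ∷ Y) (false ∷ s) .false z const | refl = labelSum-off Y s false (z ∘ suc) (const ∘ suc)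
labelSum-off (false ∷ Y) (true ∷ s) χ z const =
  trans (cong (z zero +_) (labelSum-off Y s χ (z ∘ suc) (const ∘ suc))) (sym (+-assoc (z zero) _ _))
labelSum-off (false ∷ Y) (false ∷ s) χ z const = labelSum-off Y s χ (z ∘ suc) (const ∘ suc)

find-element : ∀ {n} (Y : Vec Bool n) → 0 < size Y → Σ (Fin n) λ v → lookup Y v ≡ true
find-element (true ∷ Y) _ = zero , refl
find-element (false ∷ Y) pos = let v , eq = find-element Y pos in suc v , eq

lookup-xor : ∀ {n} (e e′ : Subset n) v → lookup (zipWith _xor_ e e′) v ≡ lookup e v xor lookup e′ v
lookup-xor (x ∷ e) (y ∷ e′) zero = refl
lookup-xor (x ∷ e) (y ∷ e′) (suc v) = lookup-xor e e′ v

<ᵇ-true : ∀ m n → (m <ᵇ n) ≡ true → m < n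
<ᵇ-true m n eq = <ᵇ⇒< m n (subst T (sym eq) _)

<ᵇ-false : ∀ m n → (m <ᵇ n) ≡ false → n ≤ m
<ᵇ-false m n eq = ≮⇒≥ λ m<n → subst T eq (<⇒<ᵇ m<n)

xor-false : ∀ {a b} → a xor b ≡ false → a ≡ b
xor-false {true} {true} _ = refl
xor-false {false} {false} _ = refl

Avoids : ∀ {n} → ℕ → (Fin n → ℕ) → Constraint n → Set
Avoids M z c = αˡ c + M * labelSum (eˡ c) z ≢ αʳ c + M * labelSum (eʳ c) z

module _ (M : ℕ) .{{_ : NonZero M}} where

  bit-solution-unique : ∀ χ χ′ → χ xor χ′ ≡ true → ∀ α β P Q x y →
    α + M * (P + bit χ x) ≡ β + M * (Q + bit χ′ x) → α + M * (P + bit χ y) ≡ β + M * (Q + bit χ′ y) → x ≡ y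
  bit-solution-unique true false _ α β P Q x y eqx eqy =
    +-cancelˡ-≡ P _ _ (*-cancelˡ-≡ _ _ M (+-cancelˡ-≡ α _ _ (trans eqx (sym eqy))))
  bit-solution-unique false true _ α β P Q x y eqx eqy =
    +-cancelˡ-≡ Q _ _ (*-cancelˡ-≡ _ _ M (+-cancelˡ-≡ β _ _ (trans (sym eqx) eqy)))

  shift-solution : ∀ α β P Q x y → α + M * (P + x) ≡ β + M * (Q + x) → α + M * (P + y) ≡ β + M * (Q + y)
  shift-solution α β P Q x y eq = trans (expand α M P y) (trans (cong (_+ M * y)
    (+-cancelʳ-≡ (M * x) _ _ (trans (sym (expand α M P x)) (trans eq (expand β M Q x))))) (sym (expand β M Q y)))
    where
    expand : ∀ a m p x → a + m * (p + x) ≡ (a + m * p) + m * x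
    expand = solve-∀

-- On a block Y that lies inside the first difference set and on which every edge is
-- constant, the number of ones is a free parameter: constraints with equal coefficients
-- on Y ignore it (and are settled recursively), each other constraint excludes one value.
binary-avoider : ∀ {n} M .{{_ : NonZero M}} T fuel (cs : List (Constraint n)) →
  length cs ≤ fuel → length cs ≤ T →
  (∀ c → c ∈ cs → 2 ^ (2 * T) * (2 * T) ≤ dist (eˡ c) (eʳ c)) →
  Σ (Fin n → ℕ) λ z → (∀ v → z v ≤ 1) × (∀ c → c ∈ cs → Avoids M z c)
binary-avoider M T fuel [] _ _ _ = (λ _ → 0) , (λ _ → z≤n) , (λ _ ())
binary-avoider {n} M T (suc fuel) cs@(c₀ ∷ cs′) (s≤s len≤fuel) len≤T far = z , z≤1 , avoids
  where
  open ≤-Reasoning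
  T>0 : 0 < T
  T>0 = ≤-trans (s≤s z≤n) len≤T
  ss = map eˡ cs ++ map eʳ cs
  length-ss : length ss ≡ 2 * length cs
  length-ss = trans (length-++ (map eˡ cs)) (trans (cong₂ _+_ (length-map eˡ cs) (length-map eʳ cs))
    (cong (length cs +_) (sym (+-identityʳ (length cs)))))
  large : 2 ^ length ss * (2 * T) ≤ dist (eˡ c₀) (eʳ c₀)
  large = begin
    2 ^ length ss * (2 * T) ≤⟨ *-monoˡ-≤ (2 * T) (^-monoʳ-≤ 2 (≤-trans (≤-reflexive length-ss) (*-monoʳ-≤ 2 len≤T))) ⟩
    2 ^ (2 * T) * (2 * T) ≤⟨ far c₀ (here refl) ⟩
    dist (eˡ c₀) (eʳ c₀) ∎
  block = homogeneous ss (zipWith _xor_ (eˡ c₀) (eʳ c₀)) (2 * T) large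
  Y = proj₁ block
  2T≤Y : 2 * T ≤ size Y
  2T≤Y = proj₁ (proj₂ (proj₂ block))
  element = find-element Y (<-≤-trans T>0 (≤-trans (m≤m+n T _) 2T≤Y))
  -- A representative of `Y` turns the constant value on `Y` into a function of the edge alone,
  -- usable without a proof that the edge is in `ss`.
  v₀ = proj₁ element
  constant : ∀ s → s ∈ ss → ∀ v → lookup Y v ≡ true → lookup s v ≡ lookup s v₀
  constant s s∈ v v∈Y = let χ , const = proj₂ (proj₂ (proj₂ block)) s s∈ in
    trans (const v v∈Y) (sym (const v₀ (proj₂ element)))
  ss∋ˡ : ∀ c → c ∈ cs → eˡ c ∈ ss
  ss∋ˡ c c∈ = ∈-++⁺ˡ (∈-map⁺ eˡ c∈)
  ss∋ʳ : ∀ c → c ∈ cs → eʳ c ∈ ss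
  ss∋ʳ c c∈ = ∈-++⁺ʳ (map eˡ cs) (∈-map⁺ eʳ c∈)
  active : Constraint n → Bool
  active = differs v₀
  active-c₀ : active c₀ ≡ true
  active-c₀ = trans (sym (lookup-xor (eˡ c₀) (eʳ c₀) v₀)) (proj₁ (proj₂ block) v₀ (proj₂ element))
  -- Since `Y` lies in the difference set of `c₀`, that constraint is active; the recursion runs on
  -- a sublist of `cs′` and thus uses less fuel, while `T` and the distance bound stay the same.
  rest = filterᵇ (not ∘ active) cs′
  length-rest : length rest ≤ length cs′
  length-rest = subst (length rest ≤_) (length-filterᵇ-+ active cs′) (m≤n+m _ _)
  recursive = binary-avoider M T fuel rest (≤-trans length-rest len≤fuel)
    (≤-trans length-rest (≤-trans (n≤1+n _) len≤T))
    (λ c c∈ → far c (there (proj₁ (∈-filterᵇ⁻ (not ∘ active) cs′ c∈))))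
  z₀ = proj₁ recursive
  side : Subset n → ℕ → ℕ
  side e x = M * labelSum e (setOn Y x z₀)
  base : Subset n → ℕ
  base e = labelSum (off Y e) z₀
  χ : Subset n → Bool
  χ e = lookup e v₀
  bad : Constraint n → ℕ → Bool
  bad c i = αˡ c + side (eˡ c) (suc i) ≡ᵇ αʳ c + side (eʳ c) (suc i)
  side-eq : ∀ e → e ∈ ss → ∀ x → x ≤ 2 * T → side e x ≡ M * (base e + bit (χ e) x)
  side-eq e e∈ x x≤ = cong (M *_) (labelSum-setOn Y e (χ e) x z₀ (constant e e∈) (≤-trans x≤ 2T≤Y))
  normal : ∀ c → c ∈ cs → ∀ x → x ≤ 2 * T → αˡ c + side (eˡ c) x ≡ αʳ c + side (eʳ c) x →
    αˡ c + M * (base (eˡ c) + bit (χ (eˡ c)) x) ≡ αʳ c + M * (base (eʳ c) + bit (χ (eʳ c)) x)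
  normal c c∈ x x≤ eq = trans (cong (αˡ c +_) (sym (side-eq (eˡ c) (ss∋ˡ c c∈) x x≤)))
    (trans eq (cong (αʳ c +_) (side-eq (eʳ c) (ss∋ʳ c c∈) x x≤)))
  at-most-one : ∀ c → c ∈ filterᵇ active cs → ∑ (downFrom (2 * T)) (𝟙 ∘ bad c) ≤ 1
  at-most-one c c∈act = ∑-at-most-one (bad c) (downFrom (2 * T)) (downFrom⁺ (2 * T)) λ {i} {j} i∈ j∈ bi bj →
    suc-injective (bit-solution-unique M (χ (eˡ c)) (χ (eʳ c)) (proj₂ c∈)
      (αˡ c) (αʳ c) (base (eˡ c)) (base (eʳ c)) (suc i) (suc j)
      (normal c (proj₁ c∈) (suc i) (∈-downFrom⁻ i∈) (≡ᵇ-sound _ _ bi))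
      (normal c (proj₁ c∈) (suc j) (∈-downFrom⁻ j∈) (≡ᵇ-sound _ _ bj)))
    where
    c∈ = ∈-filterᵇ⁻ active cs c∈act
  -- The candidate numbers of ones are 1 to `2 * T`. At most `T` active constraints exclude one
  -- candidate each, so the selection lemma applies with an empty far list.
  choice = avoid-near-spare-far (2 * T) bad (filterᵇ active cs) [] (≤-trans T>0 (m≤m+n T _)) at-most-one (λ _ ())
    (*-monoʳ-≤ 2 (≤-trans (subst (length (filterᵇ active cs) ≤_) (length-filterᵇ-+ active cs) (m≤m+n _ _)) len≤T))
  i = proj₁ choice
  z = setOn Y (suc i) z₀
  z≤1 : ∀ v → z v ≤ 1
  z≤1 = setOn≤1 Y (suc i) z₀ (proj₁ (proj₂ recursive))
  inactive : ∀ c → c ∈ cs → active c ≡ false → Avoids M z₀ c → Avoids M z c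
  inactive c c∈ same avoid₀ eq = avoid₀ (begin-equality
    αˡ c + M * labelSum (eˡ c) z₀
      ≡⟨ cong (λ s → αˡ c + M * s) (labelSum-off Y (eˡ c) (χ (eˡ c)) z₀ (constant (eˡ c) (ss∋ˡ c c∈))) ⟩
    αˡ c + M * (base (eˡ c) + bit (χ (eˡ c)) y)
      ≡⟨ shift-solution M (αˡ c) (αʳ c) (base (eˡ c)) (base (eʳ c)) (bit (χ (eˡ c)) (suc i)) (bit (χ (eˡ c)) y)
        (trans (normal c c∈ (suc i) (proj₁ (proj₂ choice)) eq)
          (cong (λ b → αʳ c + M * (base (eʳ c) + bit b (suc i))) (sym χ≡))) ⟩
    αʳ c + M * (base (eʳ c) + bit (χ (eˡ c)) y)
      ≡⟨ cong (λ b → αʳ c + M * (base (eʳ c) + bit b y)) χ≡ ⟩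
    αʳ c + M * (base (eʳ c) + bit (χ (eʳ c)) y)
      ≡⟨ cong (λ s → αʳ c + M * s) (sym (labelSum-off Y (eʳ c) (χ (eʳ c)) z₀ (constant (eʳ c) (ss∋ʳ c c∈)))) ⟩
    αʳ c + M * labelSum (eʳ c) z₀ ∎)
    where
    y = labelSum Y z₀
    χ≡ : χ (eˡ c) ≡ χ (eʳ c)
    χ≡ = xor-false same
  avoids₀ : ∀ c → c ∈ cs → active c ≡ false → Avoids M z₀ c
  avoids₀ c (here refl) inact = ⊥-elim (true≢false active-c₀ inact)
  avoids₀ c (there c∈) inact = proj₂ (proj₂ recursive) c (∈-filterᵇ⁺ (not ∘ active) c∈ (cong not inact))
  avoids : ∀ c → c ∈ cs → Avoids M z c
  avoids c c∈ = [ (λ act eq → true≢false {bad c i} (≡ᵇ-complete _ _ eq)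
                     (proj₁ (proj₂ (proj₂ choice)) c (∈-filterᵇ⁺ active c∈ act)))
                , (λ inact → inactive c c∈ inact (avoids₀ c c∈ inact)) ]′ (true-or-false (active c))

labelSum-+* : ∀ {n} (e : Subset n) r z M → labelSum e (λ v → r v + M * z v) ≡ labelSum e r + M * labelSum e z
labelSum-+* [] r z M = sym (*-zeroʳ M)
labelSum-+* (true ∷ e) r z M rewrite labelSum-+* e (r ∘ suc) (z ∘ suc) M =
  regroup (r zero) M (z zero) (labelSum e (r ∘ suc)) (labelSum e (z ∘ suc))
  where
  regroup : ∀ a m b c d → a + m * b + (c + m * d) ≡ a + c + m * (b + d)
  regroup = solve-∀
labelSum-+* (false ∷ e) r z M = labelSum-+* e (r ∘ suc) (z ∘ suc) M

-- The upper bound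

module _ {n m : ℕ} (H : Hypergraph n m) (A M : ℕ) .{{_ : NonZero M}} where

  private
    -- T₀ bounds the number of far collisions; two edges are near if they differ in fewer
    -- than K vertices.
    T₀ = 8 * A
    K = 2 ^ (2 * T₀) * (2 * T₀)

  -- Twice the average number of collisions, `m * m / M ≤ 4 * A`, explains `T₀ = 8 * A`. The near
  -- pairs have at most `4 * A * M * K` incidences and a heavy vertex takes more than `M / 2` of
  -- them, so there are at most `T₀ * K` heavy vertices, and the second hypothesis keeps their
  -- powers of two within `M`. The size of `K` is what `binary-avoider` demands for `T₀`
  -- constraints.
  labelable : m * m ≤ 4 * A * M → 2 ^ (T₀ * K) ≤ M → Labelable H (2 * M)
  labelable m²≤ 2^≤M = f , f-bounds , distinguishing
    where
    open ≤-Reasoning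
    pair : Fin m → Fin m → Constraint n
    pair i j = mk (edge H i) (edge H j) 0 0
    -- The diagonal is included; a pair of equal edges is never separated, so the greedy labelling
    -- promises nothing about it.
    cs = cartesianProductWith pair (allFin m) (allFin m)
    length-cs : length cs ≡ m * m
    length-cs = trans (length-cartesianProductWith pair (allFin m) (allFin m))
      (cong₂ _*_ (length-tabulate {n = m} id) (length-tabulate {n = m} id))
    isNear : Constraint n → Bool
    isNear c = dist (eˡ c) (eʳ c) <ᵇ K
    near = filterᵇ isNear cs
    far = filterᵇ (not ∘ isNear) cs
    length-split : length near + length far ≡ m * m
    length-split = trans (length-filterᵇ-+ isNear cs) length-cs
    heavy : Vec Bool n
    heavy = tabulate (λ v → M <ᵇ 2 * degree near v)
    near-dist : ∑ near (λ c → dist (eˡ c) (eʳ c)) ≤ length near * K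
    near-dist = subst (∑ near (λ c → dist (eˡ c) (eʳ c)) ≤_) (∑-const near K)
      (∑-mono near (λ c c∈ → <⇒≤ (<ᵇ-true _ _ (proj₂ (∈-filterᵇ⁻ isNear cs c∈)))))
    size-heavy : size heavy ≤ T₀ * K
    size-heavy = *-cancelʳ-≤ _ _ M (begin
      size heavy * M ≤⟨ markov n M (degree near) ⟩
      2 * ∑ᶠ n (degree near) ≡⟨ cong (2 *_) (∑ᶠ-degree near) ⟩
      2 * ∑ near (λ c → dist (eˡ c) (eʳ c)) ≤⟨ *-monoʳ-≤ 2 near-dist ⟩
      2 * (length near * K) ≤⟨ *-monoʳ-≤ 2 (*-monoˡ-≤ K (≤-trans (≤-trans (m≤m+n (length near) (length far)) (≤-reflexive length-split)) m²≤)) ⟩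
      2 * (4 * A * M * K) ≡⟨ regroup A M K ⟩
      8 * A * K * M ∎)
      where
      regroup : ∀ A M K → 2 * (4 * A * M * K) ≡ 8 * A * K * M
      regroup = solve-∀
    2^heavy≤M : 2 ^ size heavy ≤ M
    2^heavy≤M = ≤-trans (^-monoʳ-≤ 2 size-heavy) 2^≤M
    light : ∀ v → lookup heavy v ≡ false → 2 * degree near v ≤ M
    light v eq = <ᵇ-false M _ (trans (sym (lookup∘tabulate _ v)) eq)
    labelling = greedy M heavy (powers heavy) near far light
    r = proj₁ labelling
    fixed = proj₁ (proj₂ labelling)
    r-bounds : ∀ v → 1 ≤ r v × r v ≤ M
    r-bounds v with true-or-false (lookup heavy v)
    ... | inj₁ h rewrite fixed v h = let l , u = powers-bounds heavy v in l , ≤-trans u 2^heavy≤M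
    ... | inj₂ h = proj₁ (proj₂ (proj₂ labelling)) v h
    isBad : Constraint n → Bool
    isBad c = sep heavy c ∧ collides M r c
    bads = filterᵇ isBad far
    length-bads : length bads ≤ T₀
    length-bads = *-cancelˡ-≤ M (begin
      M * length bads ≡⟨ cong (M *_) (length-filterᵇ isBad far) ⟩
      M * ∑ far (𝟙 ∘ isBad) ≤⟨ proj₂ (proj₂ (proj₂ (proj₂ labelling))) ⟩
      2 * length far ≤⟨ *-monoʳ-≤ 2 (≤-trans (≤-trans (m≤n+m (length far) (length near)) (≤-reflexive length-split)) m²≤) ⟩
      2 * (4 * A * M) ≡⟨ regroup A M ⟩
      M * (8 * A) ∎)
      where
      regroup : ∀ A M → 2 * (4 * A * M) ≡ M * (8 * A)
      regroup = solve-∀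
    -- With `r` settled, its sums become constants and the digits are the unknowns: avoiding this
    -- constraint with factor `M` says exactly that `r + M z` separates the pair.
    offset : Constraint n → Constraint n
    offset c = mk (eˡ c) (eʳ c) (labelSum (eˡ c) r) (labelSum (eʳ c) r)
    length-offset : length (map offset bads) ≤ T₀
    length-offset = ≤-trans (≤-reflexive (length-map offset bads)) length-bads
    offset-far : ∀ c → c ∈ map offset bads → K ≤ dist (eˡ c) (eʳ c)
    offset-far c c∈ with ∈-map⁻ offset c∈
    ... | c′ , c′∈ , refl = <ᵇ-false _ _ (not-true
      (proj₂ (∈-filterᵇ⁻ (not ∘ isNear) cs (proj₁ (∈-filterᵇ⁻ isBad far c′∈)))))
    avoider = binary-avoider M T₀ T₀ (map offset bads) length-offset length-offset offset-far
    z = proj₁ avoider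
    f : Fin n → ℕ
    f v = r v + M * z v
    f-bounds : ∀ v → 1 ≤ f v × f v ≤ 2 * M
    f-bounds v = ≤-trans (proj₁ (r-bounds v)) (m≤m+n _ _) ,
      +-mono-≤ (proj₂ (r-bounds v)) (≤-trans (*-monoʳ-≤ M (proj₁ (proj₂ avoider) v)) (≤-reflexive (*-comm M 1)))
    residue : ∀ e → labelSum e f % M ≡ labelSum e r % M
    residue e = trans (cong (_% M) (trans (labelSum-+* e r z M) (cong (labelSum e r +_) (*-comm M _))))
      ([m+kn]%n≡m%n (labelSum e r) (labelSum e z) M)
    distinguishing : SumDistinguishing H f
    distinguishing i j i≢j eq = case true-or-false (sep heavy c) of λ
      { (inj₂ s) → distinct H i j i≢j (unseparated-distinct M heavy r fixed 2^heavy≤M _ _ s eq%)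
      ; (inj₁ s) → case true-or-false (isNear c) of λ
        { (inj₁ nr) → true≢false col (proj₁ (proj₂ (proj₂ (proj₂ labelling))) c (∈-filterᵇ⁺ isNear c∈ nr) s)
        ; (inj₂ fr) → proj₂ (proj₂ avoider) (offset c) (∈-map⁺ offset (∈-filterᵇ⁺ isBad
            (∈-filterᵇ⁺ (not ∘ isNear) c∈ (cong not fr)) (cong₂ _∧_ s col)))
            (trans (sym (labelSum-+* (edge H i) r z M)) (trans eq (labelSum-+* (edge H j) r z M))) } }
      where
      c = pair i j
      c∈ : c ∈ cs
      c∈ = ∈-cartesianProductWith⁺ pair (∈-allFin i) (∈-allFin j)
      eq% : labelSum (edge H i) r % M ≡ labelSum (edge H j) r % M
      eq% = trans (sym (residue (edge H i))) (trans (cong (_% M) eq) (residue (edge H j)))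
      col : collides M r c ≡ true
      col = ≡ᵇ-complete _ _ eq%

-- With 2CM ≤ m² < 2C(M+1), labels up to 2M suffice as soon as m is large.
upper : ∀ C .{{_ : NonZero C}} → Σ ℕ λ m₀ → ∀ m → m₀ ≤ m →
  Σ ℕ λ N → C * N ≤ m * m × (∀ {n} (H : Hypergraph n m) → Labelable H N)
upper C = 2 * C * 2 ^ L , bound
  where
  open ≤-Reasoning
  instance
    2C-nonZero : NonZero (2 * C)
    2C-nonZero = m*n≢0 2 C
  T₀ = 8 * C
  L = T₀ * (2 ^ (2 * T₀) * (2 * T₀))
  bound : ∀ m → 2 * C * 2 ^ L ≤ m →
    Σ ℕ λ N → C * N ≤ m * m × (∀ {n} (H : Hypergraph n m) → Labelable H N)
  bound m m₀≤m = 2 * M ,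
    (begin
      C * (2 * M) ≡⟨ regroup C M ⟩
      M * (2 * C) ≤⟨ m/n*n≤m (m * m) (2 * C) ⟩
      m * m ∎) ,
    λ H → labelable H C M {{>-nonZero M>0}} m²≤ 2^L≤M
    where
    M = m * m / (2 * C)
    regroup : ∀ C M → C * (2 * M) ≡ M * (2 * C)
    regroup = solve-∀
    m>0 : 0 < m
    m>0 = <-≤-trans (*-mono-< {0} {2 * C} {0} {2 ^ L} (>-nonZero⁻¹ (2 * C)) (m^n>0 2 L)) m₀≤m
    2^L≤M : 2 ^ L ≤ M
    2^L≤M = begin
      2 ^ L ≡⟨ sym (m*n/n≡m (2 ^ L) (2 * C)) ⟩
      2 ^ L * (2 * C) / (2 * C) ≤⟨ /-monoˡ-≤ (2 * C) (begin
        2 ^ L * (2 * C) ≡⟨ *-comm (2 ^ L) (2 * C) ⟩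
        2 * C * 2 ^ L ≤⟨ m₀≤m ⟩
        m ≡⟨ sym (*-identityʳ m) ⟩
        m * 1 ≤⟨ *-monoʳ-≤ m m>0 ⟩
        m * m ∎) ⟩
      m * m / (2 * C) ∎
    M>0 : 0 < M
    M>0 = <-≤-trans (m^n>0 2 L) 2^L≤M
    m²≤ : m * m ≤ 4 * C * M
    m²≤ = begin
      m * m ≡⟨ m≡m%n+[m/n]*n (m * m) (2 * C) ⟩
      m * m % (2 * C) + M * (2 * C) ≤⟨ +-monoˡ-≤ _ (<⇒≤ (m%n<n (m * m) (2 * C))) ⟩
      2 * C + M * (2 * C) ≤⟨ +-monoˡ-≤ _ (≤-trans (≤-reflexive (sym (*-identityˡ (2 * C)))) (*-monoˡ-≤ (2 * C) M>0)) ⟩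
      M * (2 * C) + M * (2 * C) ≡⟨ double C M ⟩
      4 * C * M ∎
      where
      double : ∀ C M → M * (2 * C) + M * (2 * C) ≡ 4 * C * M
      double = solve-∀

-- Hypergraphs that need large labels

-- Greedy set cover. If each member of `F` is served by a share 1/t of the points, double counting
-- gives a point that serves a share 1/t of any sublist. Then `t` points leave at most half of `F`
-- unserved, and `σ` rounds exhaust fewer than `2 ^ σ` members.
module Covering {Φ X : Set} (G : Φ → X → Bool) (xs : List X) (t : ℕ) .{{_ : NonZero t}} (xs≢[] : 0 < length xs) where

  Dense : List Φ → Set
  Dense F = ∀ f → f ∈ F → length xs ≤ t * ∑ xs (𝟙 ∘ G f)

  Covered : Φ → List X → Set
  Covered f ys = Σ X λ y → y ∈ ys × G f y ≡ true

  isUncovered : List X → Φ → Bool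
  isUncovered ys f = not (any (G f) ys)

  uncovered : List X → List Φ → List Φ
  uncovered ys = filterᵇ (isUncovered ys)

  uncovered-dense : ∀ ys F → Dense F → Dense (uncovered ys F)
  uncovered-dense ys F dense f f∈ = dense f (proj₁ (∈-filterᵇ⁻ (isUncovered ys) F f∈))

  dense-point : ∀ F → Dense F → Σ X λ x → length F ≤ t * ∑ F (λ f → 𝟙 (G f x))
  dense-point F dense =
    let x , _ , avg = above-average xs hits xs≢[] in
    x , *-cancelˡ-≤ (length xs) {{>-nonZero xs≢[]}} (begin
      length xs * length F ≡⟨ *-comm (length xs) (length F) ⟩
      length F * length xs ≡⟨ sym (∑-const F (length xs)) ⟩
      ∑ F (λ _ → length xs) ≤⟨ ∑-mono F dense ⟩
      ∑ F (λ f → t * ∑ xs (𝟙 ∘ G f)) ≡⟨ ∑-*ˡ F t (λ f → ∑ xs (𝟙 ∘ G f)) ⟩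
      t * ∑ F (λ f → ∑ xs (𝟙 ∘ G f)) ≡⟨ cong (t *_) (∑-swap F xs (λ f x → 𝟙 (G f x))) ⟩
      t * ∑ xs hits ≤⟨ *-monoʳ-≤ t avg ⟩
      t * (length xs * hits x) ≡⟨ *-swap t (length xs) (hits x) ⟩
      length xs * (t * hits x) ∎)
    where
    open ≤-Reasoning
    hits : X → ℕ
    hits x = ∑ F (λ f → 𝟙 (G f x))
    *-swap : ∀ a b c → a * (b * c) ≡ b * (a * c)
    *-swap = solve-∀

  uncovered-∷ : ∀ x ys F →
    length (uncovered ys F) ≡ ∑ (uncovered ys F) (λ f → 𝟙 (G f x)) + length (uncovered (x ∷ ys) F)
  uncovered-∷ x ys [] = refl
  uncovered-∷ x ys (f ∷ F) with any (G f) ys | G f x in eq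
  ... | true | true = uncovered-∷ x ys F
  ... | true | false = uncovered-∷ x ys F
  ... | false | true rewrite eq = cong suc (uncovered-∷ x ys F)
  ... | false | false rewrite eq = trans (cong suc (uncovered-∷ x ys F)) (sym (+-suc _ _))

  -- As long as more than half of F is uncovered, each new point covers at least |F| / 2t.
  partial-cover : ∀ i F → Dense F → Σ (List X) λ ys → length ys ≡ i ×
    (2 * length (uncovered ys F) ≤ length F ⊎
     i * length F + 2 * t * length (uncovered ys F) ≤ 2 * t * length F)
  partial-cover zero F dense = [] , refl ,
    inj₂ (*-monoʳ-≤ (2 * t) (length-filter _ F))
  partial-cover (suc i) F dense with partial-cover i F dense
  ... | ys , len , bound with dense-point (uncovered ys F) (uncovered-dense ys F dense)
  ...   | x , covers = x ∷ ys , cong suc len , step bound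
    where
    open ≤-Reasoning
    u = length (uncovered ys F)
    u′ = length (uncovered (x ∷ ys) F)
    cov = ∑ (uncovered ys F) (λ f → 𝟙 (G f x))
    u′≤u : u′ ≤ u
    u′≤u = subst (u′ ≤_) (sym (uncovered-∷ x ys F)) (m≤n+m u′ cov)
    regroup : ∀ i F t c u → i * F + (2 * (t * c) + 2 * t * u) ≡ i * F + 2 * t * (c + u)
    regroup = solve-∀
    regroup′ : ∀ i F u t → (F + i * F) + 2 * t * u ≡ i * F + (F + 2 * t * u)
    regroup′ = solve-∀
    step : 2 * u ≤ length F ⊎ i * length F + 2 * t * u ≤ 2 * t * length F →
      2 * u′ ≤ length F ⊎ suc i * length F + 2 * t * u′ ≤ 2 * t * length F
    step (inj₁ le) = inj₁ (≤-trans (*-monoʳ-≤ 2 u′≤u) le)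
    step (inj₂ le) with 2 * u ≤? length F
    ... | yes le′ = inj₁ (≤-trans (*-monoʳ-≤ 2 u′≤u) le′)
    ... | no gt = inj₂ (begin
      suc i * length F + 2 * t * u′ ≡⟨ regroup′ i (length F) u′ t ⟩
      i * length F + (length F + 2 * t * u′) ≤⟨ +-monoʳ-≤ (i * length F) (+-monoˡ-≤ (2 * t * u′)
        (≤-trans (<⇒≤ (≰⇒> gt)) (*-monoʳ-≤ 2 covers))) ⟩
      i * length F + (2 * (t * cov) + 2 * t * u′) ≡⟨ regroup i (length F) t cov u′ ⟩
      i * length F + 2 * t * (cov + u′) ≡⟨ cong (λ k → i * length F + 2 * t * k) (sym (uncovered-∷ x ys F)) ⟩
      i * length F + 2 * t * u ≤⟨ le ⟩
      2 * t * length F ∎)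

  half-cover : ∀ F → Dense F → Σ (List X) λ ys → length ys ≡ t × 2 * length (uncovered ys F) ≤ length F
  half-cover F dense with partial-cover t F dense
  ... | ys , len , inj₁ le = ys , len , le
  -- After exactly `t` points the accumulated inequality cancels to the desired halving.
  ... | ys , len , inj₂ le = ys , len , *-cancelˡ-≤ t (+-cancelˡ-≤ (t * length F) _ _
    (subst₂ _≤_ (regroup t (length F) _) (double t (length F)) le))
    where
    regroup : ∀ t F u → t * F + 2 * t * u ≡ t * F + t * (2 * u)
    regroup = solve-∀
    double : ∀ t F → 2 * t * F ≡ t * F + t * F
    double = solve-∀

  cover : ∀ σ F → Dense F → length F < 2 ^ σ →
    Σ (List X) λ ys → length ys ≡ σ * t × (∀ f → f ∈ F → Covered f ys)
  cover zero [] dense _ = [] , refl , λ _ ()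
  cover zero (f ∷ F) dense (s≤s ())
  cover (suc σ) F dense small with half-cover F dense
  ... | ys , len , halved with cover σ (uncovered ys F) (uncovered-dense ys F dense)
    (*-cancelˡ-< 2 _ _ (≤-<-trans halved small))
  ...   | zs , len′ , covers = ys ++ zs , trans (length-++ ys) (cong₂ _+_ len len′) , all-covered
    where
    all-covered : ∀ f → f ∈ F → Covered f (ys ++ zs)
    all-covered f f∈ with any (G f) ys in eq
    ... | true = let y , y∈ , g = any-true⁻ (G f) ys eq in y , ∈-++⁺ˡ y∈ , g
    ... | false = let y , y∈ , g = covers f (∈-filterᵇ⁺ (isUncovered ys) f∈ (cong not eq)) in
      y , ∈-++⁺ʳ ys y∈ , g

-- A class of N elements with equal w contributes N² to the double sum, and N² + 4 ≥ 4N.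
coincidences : ∀ {E : Set} (es : List E) (w : E → ℕ) V → (∀ e → w e < V) →
  4 * length es ≤ ∑ es (λ e → ∑ es (λ e′ → 𝟙 (w e′ ≡ᵇ w e))) + V * 4
coincidences es w V w<V = begin
  4 * length es ≡⟨ cong (4 *_) (sym (trans (∑-const es 1) (*-identityʳ (length es)))) ⟩
  4 * ∑ es (λ _ → 1) ≡⟨ cong (4 *_) (∑-cong es (λ e → sym (∑-downFrom-point V (w e) (λ _ → 1) (w<V e)))) ⟩
  4 * ∑ es (λ e → ∑ (downFrom V) (λ x → 𝟙 (w e ≡ᵇ x) * 1)) ≡⟨ cong (4 *_) (∑-swap es (downFrom V) _) ⟩
  4 * ∑ (downFrom V) (λ x → ∑ es (λ e → 𝟙 (w e ≡ᵇ x) * 1))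
    ≡⟨ cong (4 *_) (∑-cong (downFrom V) (λ x → ∑-cong es (λ e → *-identityʳ (𝟙 (w e ≡ᵇ x))))) ⟩
  4 * ∑ (downFrom V) N ≡⟨ sym (∑-*ˡ (downFrom V) 4 N) ⟩
  ∑ (downFrom V) (λ x → 4 * N x) ≤⟨ ∑-mono (downFrom V) (λ x _ → square (N x)) ⟩
  ∑ (downFrom V) (λ x → N x * N x + 4) ≡⟨ ∑-+ (downFrom V) (λ x → N x * N x) (λ _ → 4) ⟩
  ∑ (downFrom V) (λ x → N x * N x) + ∑ (downFrom V) (λ _ → 4)
    ≡⟨ cong₂ _+_ (sym classes) (trans (∑-const (downFrom V) 4) (cong (_* 4) (length-downFrom V))) ⟩
  ∑ es (λ e → N (w e)) + V * 4 ∎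
  where
  open ≤-Reasoning
  N : ℕ → ℕ
  N x = ∑ es (λ e → 𝟙 (w e ≡ᵇ x))
  square : ∀ k → 4 * k ≤ k * k + 4
  square zero = z≤n
  square (suc zero) = s≤s (s≤s (s≤s (s≤s z≤n)))
  square (suc (suc k)) = subst (4 * (2 + k) ≤_) (expand k) (m≤m+n (4 * (2 + k)) (k * k))
    where
    expand : ∀ k → 4 * (2 + k) + k * k ≡ (2 + k) * (2 + k) + 4
    expand = solve-∀
  classes : ∑ es (λ e → N (w e)) ≡ ∑ (downFrom V) (λ x → N x * N x)
  classes = begin-equality
    ∑ es (λ e → N (w e)) ≡⟨ ∑-cong es (λ e → sym (∑-downFrom-point V (w e) N (w<V e))) ⟩
    ∑ es (λ e → ∑ (downFrom V) (λ x → 𝟙 (w e ≡ᵇ x) * N x)) ≡⟨ ∑-swap es (downFrom V) _ ⟩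
    ∑ (downFrom V) (λ x → ∑ es (λ e → 𝟙 (w e ≡ᵇ x) * N x))
      ≡⟨ ∑-cong (downFrom V) (λ x → trans (∑-cong es (λ e → *-comm (𝟙 (w e ≡ᵇ x)) (N x))) (∑-*ˡ es (N x) (λ e → 𝟙 (w e ≡ᵇ x)))) ⟩
    ∑ (downFrom V) (λ x → N x * N x) ∎

-- Block c consists of the pairs (c , d). A pair is killed by c if it lies outside block c
-- but shares its value with a member of block c.
module Blocks {C D : Set} (_≟ᶜ_ : DecidableEquality C) (cs : List C) (ds : List D) (v : C → D → ℕ) where

  private
    h = length ds

  same? : C → C → Bool
  same? c c′ = does (c ≟ᶜ c′)

  matches : C → ℕ
  matches c = ∑ ds (λ d → ∑ cs (λ c′ → ∑ ds (λ d′ → 𝟙 (v c′ d′ ≡ᵇ v c d))))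

  -- `matches c` includes the `h` coincidences of members of block c with themselves; the threshold
  -- `2 * h` leaves another `h` for elements outside the block.
  good : C → Bool
  good c = not (matches c <ᵇ 2 * h)

  hits : C → C × D → Bool
  hits c (c′ , d′) = any (λ d → v c′ d′ ≡ᵇ v c d) ds

  kills : C → C × D → Bool
  kills c e = not (same? c (proj₁ e)) ∧ hits c e

  kills⇒≢ : ∀ {c} e → kills c e ≡ true → c ≢ proj₁ e
  kills⇒≢ {c} e killed refl with c ≟ᶜ c
  kills⇒≢ e () refl | yes _
  ... | no c≢c = c≢c refl

  kills⇒hits : ∀ {c} e → kills c e ≡ true → Σ D λ d → v (proj₁ e) (proj₂ e) ≡ v c d
  kills⇒hits {c} e killed =
    let d , _ , same = any-true⁻ (λ d → v (proj₁ e) (proj₂ e) ≡ᵇ v c d) ds (proj₂ (∧-true {not (same? c (proj₁ e))} killed))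
    in d , ≡ᵇ-sound (v (proj₁ e) (proj₂ e)) (v c d) same

  -- If more than half of the blocks were bad, their elements `es` would satisfy
  -- `4 * V ≤ 2 * length es`. By `coincidences` there would be at least `2 * length es` matching
  -- pairs among them, an average of `2 * h` per bad block, which contradicts badness.
  good-half : ∀ V → (∀ c d → v c d < V) → 4 * V ≤ length cs * h → 0 < length cs → length cs ≤ 2 * ∑ cs (𝟙 ∘ good)
  good-half V v<V 4V≤ cs≢[] with length cs ≤? 2 * ∑ cs (𝟙 ∘ good)
  ... | yes le = le
  ... | no gt = contradiction cs≢[] (≤⇒≯ (≤-trans (<⇒≤ cs<2bad) (≤-reflexive (cong (2 *_) bad≡0))))
    where
    open ≤-Reasoning
    bad : List C
    bad = filterᵇ (not ∘ good) cs
    cs<2bad : length cs < 2 * length bad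
    cs<2bad = +-cancelˡ-< (length cs) _ _ (begin-strict
      length cs + length cs ≡⟨ cong (length cs +_) (sym (+-identityʳ (length cs))) ⟩
      2 * length cs ≡⟨ cong (2 *_) (sym (length-filterᵇ-+ good cs)) ⟩
      2 * (length (filterᵇ good cs) + length bad) ≡⟨ *-distribˡ-+ 2 (length (filterᵇ good cs)) (length bad) ⟩
      2 * length (filterᵇ good cs) + 2 * length bad ≡⟨ cong (λ k → 2 * k + 2 * length bad) (length-filterᵇ good cs) ⟩
      2 * ∑ cs (𝟙 ∘ good) + 2 * length bad <⟨ +-monoˡ-< (2 * length bad) (≰⇒> gt) ⟩
      length cs + 2 * length bad ∎)
    es : List (C × D)
    es = cartesianProduct bad ds
    w : C × D → ℕ
    w (c , d) = v c d
    pairs : ℕ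
    pairs = ∑ es (λ e → ∑ es (λ e′ → 𝟙 (w e′ ≡ᵇ w e)))
    length-es : length es ≡ length bad * h
    length-es = length-cartesianProductWith _,_ bad ds
    pairs≤ : pairs ≤ ∑ bad matches
    pairs≤ = begin
      pairs ≡⟨ ∑-cartesianProduct bad ds _ ⟩
      ∑ bad (λ c → ∑ ds (λ d → ∑ es (λ e′ → 𝟙 (w e′ ≡ᵇ v c d))))
        ≡⟨ ∑-cong bad (λ c → ∑-cong ds (λ d → ∑-cartesianProduct bad ds _)) ⟩
      ∑ bad (λ c → ∑ ds (λ d → ∑ bad (λ c′ → ∑ ds (λ d′ → 𝟙 (v c′ d′ ≡ᵇ v c d)))))
        ≤⟨ ∑-mono bad (λ c _ → ∑-mono ds (λ d _ → ∑-filter-≤ (not ∘ good) cs (λ c′ → ∑ ds (λ d′ → 𝟙 (v c′ d′ ≡ᵇ v c d))))) ⟩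
      ∑ bad matches ∎
    -- The strict gap in every bad block is what forces `length bad` to be zero in the end.
    matches< : ∀ c → c ∈ bad → matches c + 1 ≤ 2 * h
    matches< c c∈ with matches c <ᵇ 2 * h in eq | proj₂ (∈-filterᵇ⁻ (not ∘ good) cs c∈)
    ... | true | _ = subst (_≤ 2 * h) (+-comm 1 (matches c)) (<ᵇ⇒< (matches c) (2 * h) (subst T (sym eq) _))
    bad-matches : ∑ bad matches + length bad ≤ length bad * (2 * h)
    bad-matches = begin
      ∑ bad matches + length bad ≡⟨ cong (∑ bad matches +_) (sym (trans (∑-const bad 1) (*-identityʳ (length bad)))) ⟩
      ∑ bad matches + ∑ bad (λ _ → 1) ≡⟨ sym (∑-+ bad matches (λ _ → 1)) ⟩
      ∑ bad (λ c → matches c + 1) ≤⟨ ∑-mono bad matches< ⟩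
      ∑ bad (λ _ → 2 * h) ≡⟨ ∑-const bad (2 * h) ⟩
      length bad * (2 * h) ∎
    regroup : ∀ b h → b * (2 * h) + 2 * b * h ≡ 4 * (b * h)
    regroup = solve-∀
    lower-pairs : length bad * (2 * h) ≤ pairs
    lower-pairs = +-cancelʳ-≤ (2 * length bad * h) _ _ (begin
      length bad * (2 * h) + 2 * length bad * h ≡⟨ regroup (length bad) h ⟩
      4 * (length bad * h) ≡⟨ cong (4 *_) (sym length-es) ⟩
      4 * length es ≤⟨ coincidences es w V (λ e → v<V (proj₁ e) (proj₂ e)) ⟩
      pairs + V * 4 ≡⟨ cong (pairs +_) (*-comm V 4) ⟩
      pairs + 4 * V ≤⟨ +-monoʳ-≤ pairs (≤-trans 4V≤ (*-monoˡ-≤ h (<⇒≤ cs<2bad))) ⟩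
      pairs + 2 * length bad * h ∎)
    bad≡0 : length bad ≡ 0
    bad≡0 = n≤0⇒n≡0 (+-cancelˡ-≤ (length bad * (2 * h)) _ _ (begin
      length bad * (2 * h) + length bad ≤⟨ +-monoˡ-≤ (length bad) (≤-trans lower-pairs pairs≤) ⟩
      ∑ bad matches + length bad ≤⟨ bad-matches ⟩
      length bad * (2 * h) ≡⟨ sym (+-identityʳ _) ⟩
      length bad * (2 * h) + 0 ∎))

  -- Because `v c` is injective, an element meets at most one member of block c, so `matches c`
  -- counts elements. At most `h` of these lie in the block itself.
  good⇒kills : Unique cs → Unique ds → ∀ c → (∀ {d d′} → d ∈ ds → d′ ∈ ds → v c d ≡ v c d′ → d ≡ d′) →
    good c ≡ true → h ≤ ∑ (cartesianProduct cs ds) (𝟙 ∘ kills c)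
  good⇒kills ucs uds c inj isGood = +-cancelʳ-≤ h _ _ (begin
    h + h ≡⟨ cong (h +_) (sym (+-identityʳ h)) ⟩
    2 * h ≤⟨ 2h≤matches isGood ⟩
    matches c ≡⟨ ∑-swap ds cs _ ⟩
    ∑ cs (λ c′ → ∑ ds (λ d → ∑ ds (λ d′ → 𝟙 (v c′ d′ ≡ᵇ v c d)))) ≡⟨ ∑-cong cs (λ c′ → ∑-swap ds ds _) ⟩
    ∑ cs (λ c′ → ∑ ds (λ d′ → ∑ ds (λ d → 𝟙 (v c′ d′ ≡ᵇ v c d))))
      ≤⟨ ∑-mono cs (λ c′ _ → ∑-mono ds (λ d′ _ → ≤-trans (∑-at-most-one-any _ ds (at-most-one c′ d′)) (split (same? c c′) (hits c (c′ , d′))))) ⟩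
    ∑ cs (λ c′ → ∑ ds (λ d′ → 𝟙 (kills c (c′ , d′)) + 𝟙 (same? c c′)))
      ≡⟨ sym (∑-cartesianProduct cs ds (λ e → 𝟙 (kills c e) + 𝟙 (same? c (proj₁ e)))) ⟩
    ∑ es (λ e → 𝟙 (kills c e) + 𝟙 (same? c (proj₁ e))) ≡⟨ ∑-+ es (𝟙 ∘ kills c) (λ e → 𝟙 (same? c (proj₁ e))) ⟩
    ∑ es (𝟙 ∘ kills c) + ∑ es (λ e → 𝟙 (same? c (proj₁ e))) ≤⟨ +-monoʳ-≤ (∑ es (𝟙 ∘ kills c)) own ⟩
    ∑ es (𝟙 ∘ kills c) + h ∎)
    where
    open ≤-Reasoning
    es = cartesianProduct cs ds
    2h≤matches : good c ≡ true → 2 * h ≤ matches c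
    2h≤matches g with matches c <ᵇ 2 * h in eq
    ... | false = ≮⇒≥ λ lt → subst T eq (<⇒<ᵇ lt)
    at-most-one : ∀ c′ d′ → ∑ ds (λ d → 𝟙 (v c′ d′ ≡ᵇ v c d)) ≤ 1
    at-most-one c′ d′ = ∑-at-most-one _ ds uds λ {x} {y} x∈ y∈ px py →
      inj x∈ y∈ (trans (sym (≡ᵇ-sound (v c′ d′) _ px)) (≡ᵇ-sound (v c′ d′) _ py))
    split : ∀ a b → 𝟙 b ≤ 𝟙 (not a ∧ b) + 𝟙 a
    split true b = 𝟙≤1 b
    split false b = m≤m+n (𝟙 b) 0
    same-sound : ∀ {c c′} → same? c c′ ≡ true → c ≡ c′
    same-sound {c} {c′} eq with c ≟ᶜ c′
    ... | yes p = p
    own : ∑ es (λ e → 𝟙 (same? c (proj₁ e))) ≤ h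
    own = begin
      ∑ es (λ e → 𝟙 (same? c (proj₁ e))) ≡⟨ ∑-cartesianProduct cs ds _ ⟩
      ∑ cs (λ c′ → ∑ ds (λ _ → 𝟙 (same? c c′))) ≡⟨ ∑-cong cs (λ c′ → ∑-const ds (𝟙 (same? c c′))) ⟩
      ∑ cs (λ c′ → h * 𝟙 (same? c c′)) ≡⟨ ∑-*ˡ cs h (λ c′ → 𝟙 (same? c c′)) ⟩
      h * ∑ cs (λ c′ → 𝟙 (same? c c′)) ≤⟨ *-monoʳ-≤ h (∑-at-most-one (same? c) cs ucs
        (λ _ _ px py → trans (sym (same-sound px)) (same-sound py))) ⟩
      h * 1 ≡⟨ *-identityʳ h ⟩
      h ∎

-- Enumerating subsets and labellings

_≟ˢ_ : ∀ {n} → DecidableEquality (Subset n)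
_≟ˢ_ = Vec.≡-dec Bool._≟_

vecs : List A → ∀ n → List (Vec A n)
vecs xs zero = [] ∷ []
vecs xs (suc n) = cartesianProductWith _∷_ xs (vecs xs n)

length-vecs : ∀ (xs : List A) n → length (vecs xs n) ≡ length xs ^ n
length-vecs xs zero = refl
length-vecs xs (suc n) = trans (length-cartesianProductWith _∷_ xs (vecs xs n)) (cong (length xs *_) (length-vecs xs n))

∈-vecs : ∀ {xs : List A} → (∀ x → x ∈ xs) → ∀ {n} (w : Vec A n) → w ∈ vecs xs n
∈-vecs all∈ [] = here refl
∈-vecs all∈ (x ∷ w) = ∈-cartesianProductWith⁺ _∷_ (all∈ x) (∈-vecs all∈ w)

vecs-unique : ∀ {xs : List A} → Unique xs → ∀ n → Unique (vecs xs n)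
vecs-unique u zero = All.[] ∷ []
vecs-unique u (suc n) = cartesianProductWith⁺ _∷_ Vec.∷-injective u (vecs-unique u n)

bools : List Bool
bools = true ∷ false ∷ []

cube : ∀ n → List (Subset n)
cube = vecs bools

∈-cube : ∀ {n} (e : Subset n) → e ∈ cube n
∈-cube = ∈-vecs λ { true → here refl ; false → there (here refl) }

cube-unique : ∀ n → Unique (cube n)
cube-unique = vecs-unique (((λ ()) All.∷ All.[]) ∷ (All.[] ∷ []))

length-cube : ∀ n → length (cube n) ≡ 2 ^ n
length-cube = length-vecs bools

labelSum-cong : ∀ {n} (e : Subset n) {f g : Fin n → ℕ} → (∀ v → f v ≡ g v) → labelSum e f ≡ labelSum e g
labelSum-cong [] eq = refl
labelSum-cong (true ∷ e) eq = cong₂ _+_ (eq zero) (labelSum-cong e (eq ∘ suc))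
labelSum-cong (false ∷ e) eq = labelSum-cong e (eq ∘ suc)

labelSum-++ : ∀ {k l} (c : Subset k) (d : Subset l) f →
  labelSum (c Vec.++ d) f ≡ labelSum c (λ v → f (v ↑ˡ l)) + labelSum d (λ v → f (k ↑ʳ v))
labelSum-++ [] d f = refl
labelSum-++ {l = l} (true ∷ c) d f = trans (cong (f zero +_) (labelSum-++ c d (f ∘ suc))) (sym (+-assoc (f zero) _ _))
labelSum-++ (false ∷ c) d f = labelSum-++ c d (f ∘ suc)

labelSum≤ : ∀ {n} (e : Subset n) f N → (∀ v → f v ≤ N) → labelSum e f ≤ n * N
labelSum≤ [] f N le = z≤n
labelSum≤ (true ∷ e) f N le = +-mono-≤ (le zero) (labelSum≤ e (f ∘ suc) N (le ∘ suc))
labelSum≤ (false ∷ e) f N le = ≤-trans (labelSum≤ e (f ∘ suc) N (le ∘ suc)) (m≤n+m _ N)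

-- Labellings as vectors over a finite set can be listed, both for the covering argument and for
-- decision by search. The successor moves the range to 1, ..., N.
label : ∀ {n N} → Vec (Fin N) n → Fin n → ℕ
label w v = suc (toℕ (lookup w v))

label≤ : ∀ {n N} (w : Vec (Fin N) n) v → label w v ≤ N
label≤ w v = toℕ<n (lookup w v)

encode : ∀ {n N} (f : Fin n → ℕ) → (∀ v → 1 ≤ f v × f v ≤ N) → Σ (Vec (Fin N) n) λ w → ∀ v → label w v ≡ f v
encode {n} {N} f bounds = tabulate code′ , λ v → trans (cong (suc ∘ toℕ) (lookup∘tabulate code′ v)) (code′-eq v (f v) refl)
  where
  pred< : ∀ x → 1 ≤ x × x ≤ N → x ∸ 1 < N
  pred< (suc x) (_ , x<N) = x<N
  code′ : Fin n → Fin N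
  code′ v = fromℕ< (pred< (f v) (bounds v))
  code′-eq : ∀ v x → f v ≡ x → suc (toℕ (code′ v)) ≡ f v
  code′-eq v zero eq = contradiction (subst (1 ≤_) eq (proj₁ (bounds v))) λ ()
  code′-eq v (suc x) eq = trans (cong suc (trans (toℕ-fromℕ< _) (cong (_∸ 1) eq))) (sym eq)

Distinguishes : ∀ {n} → (Fin n → ℕ) → List (Subset n) → Set
Distinguishes f E = ∀ {e e′} → e ∈ E → e′ ∈ E → e ≢ e′ → labelSum e f ≢ labelSum e′ f

-- Edges c ++ d with c taken from a short list hitting a good block of every labelling,
-- together with a short list of edges each labelling maps into one of those blocks.
module Hard (l N σ : ℕ) (small : (2 + l + l) * N < 2 ^ (2 * l)) (few : N ^ (2 + l + l) < 2 ^ σ) (σ>0 : 0 < σ) where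

  private
    -- The two additional vertices make the subsets of X ⊔ Y four times as numerous as the possible
    -- sums, as `good-half` requires.
    k = 2 + l
    Labelling = Vec (Fin N) (k + l)
    cs = cube k
    ds = cube l

    length>0 : ∀ n → 0 < length (cube n)
    length>0 n = subst (0 <_) (sym (length-cube n)) (m^n>0 2 n)

    value : Labelling → Subset k → Subset l → ℕ
    value w c d = labelSum (c Vec.++ d) (label w)

    dsum : Labelling → Subset l → ℕ
    dsum w d = labelSum d (λ v → label w (k ↑ʳ v))

    module B (w : Labelling) = Blocks _≟ˢ_ cs ds (value w)

    -- Only these labellings have to be killed: any other one repeats a sum inside every block, and
    -- all edges of a chosen block are present.
    Inj : Labelling → Set
    Inj w = All (λ d → All (λ d′ → dsum w d ≡ dsum w d′ → d ≡ d′) ds) ds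

    inj? : ∀ w → Dec (Inj w)
    inj? w = all? (λ d → all? (λ d′ → (dsum w d ≟ dsum w d′) →-dec (d ≟ˢ d′)) ds) ds

    F : List Labelling
    F = List.filter inj? (vecs (allFin N) (k + l))

    length-F : length F < 2 ^ σ
    length-F = ≤-<-trans (length-filter inj? (vecs (allFin N) (k + l)))
      (subst (_< 2 ^ σ) (sym (trans (length-vecs (allFin N) (k + l)) (cong (_^ (k + l)) (length-tabulate {n = N} id)))) few)

    value< : ∀ w c d → value w c d < 2 ^ (2 * l)
    value< w c d = ≤-<-trans (labelSum≤ (c Vec.++ d) (label w) N (label≤ w)) small

    sizes : 4 * 2 ^ (2 * l) ≤ length cs * length ds
    sizes = ≤-reflexive (begin
      4 * 2 ^ (2 * l) ≡⟨ sym (^-distribˡ-+-* 2 2 (2 * l)) ⟩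
      2 ^ (2 + 2 * l) ≡⟨ cong (2 ^_) (regroup l) ⟩
      2 ^ (k + l) ≡⟨ ^-distribˡ-+-* 2 k l ⟩
      2 ^ k * 2 ^ l ≡⟨ sym (cong₂ _*_ (length-cube k) (length-cube l)) ⟩
      length cs * length ds ∎)
      where
      open ≡-Reasoning
      regroup : ∀ l → 2 + 2 * l ≡ 2 + l + l
      regroup = solve-∀

    module Cover₁ = Covering (λ w c → B.good w c) cs 2 (length>0 k)

    phase₁ = Cover₁.cover σ F (λ w _ → B.good-half w (2 ^ (2 * l)) (value< w) sizes (length>0 k)) length-F
    blocks : List (Subset k)
    blocks = proj₁ phase₁

    es = cartesianProduct cs ds

    -- A killer may act on any chosen block. So the relation to be covered does not depend on which
    -- block is good for the labelling, although the good one alone already supplies enough killers.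
    kill : Labelling → Subset k × Subset l → Bool
    kill w e = any (λ c → B.kills w c e) blocks

    instance
      cs-nonZero : NonZero (length cs)
      cs-nonZero = >-nonZero (length>0 k)

    length-es : length es ≡ length cs * length ds
    length-es = length-cartesianProductWith _,_ cs ds

    module Cover₂ = Covering kill es (length cs)
      (subst (0 <_) (sym length-es) (*-mono-< (length>0 k) (length>0 l)))

    ∈-F : ∀ w → Inj w → w ∈ F
    ∈-F w inj = ∈-filter⁺ inj? (∈-vecs ∈-allFin w) inj

    value-injective : ∀ w → Inj w → ∀ c {d d′} → d ∈ ds → d′ ∈ ds → value w c d ≡ value w c d′ → d ≡ d′
    value-injective w inj c {d} {d′} d∈ d′∈ eq = All.lookup (All.lookup inj d∈) d′∈
      (+-cancelˡ-≡ _ (dsum w d) (dsum w d′) (trans (sym (labelSum-++ c d (label w))) (trans eq (labelSum-++ c d′ (label w)))))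

    dense₂ : ∀ w → w ∈ F → length es ≤ length cs * ∑ es (𝟙 ∘ kill w)
    dense₂ w w∈ = let
        inj = proj₂ (∈-filter⁻ inj? {xs = vecs (allFin N) (k + l)} w∈)
        c , c∈ , good = proj₂ (proj₂ phase₁) w w∈
      in begin
      length es ≡⟨ length-es ⟩
      length cs * length ds ≤⟨ *-monoʳ-≤ (length cs)
        (B.good⇒kills w (cube-unique k) (cube-unique l) c (value-injective w inj c) good) ⟩
      length cs * ∑ es (𝟙 ∘ B.kills w c) ≤⟨ *-monoʳ-≤ (length cs)
        (∑-mono es (λ e _ → 𝟙-mono (any-true⁺ (λ c → B.kills w c e) c∈))) ⟩
      length cs * ∑ es (𝟙 ∘ kill w) ∎
      where open ≤-Reasoning

    phase₂ = Cover₂.cover σ F dense₂ length-F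
    killers : List (Subset k × Subset l)
    killers = proj₁ phase₂

  -- Repetitions are possible, for instance when a killer of one block belongs to another; they are
  -- removed in `embed`.
  edges : List (Subset (k + l))
  edges = cartesianProductWith Vec._++_ blocks ds ++ map (uncurry Vec._++_) killers

  length-edges : length edges ≡ 6 * σ * 2 ^ l
  length-edges = begin
    length edges ≡⟨ length-++ (cartesianProductWith Vec._++_ blocks ds) ⟩
    length (cartesianProductWith Vec._++_ blocks ds) + length (map (uncurry Vec._++_) killers)
      ≡⟨ cong₂ _+_ (length-cartesianProductWith Vec._++_ blocks ds) (length-map (uncurry Vec._++_) killers) ⟩
    length blocks * length ds + length killers
      ≡⟨ cong₂ _+_ (cong₂ _*_ (proj₁ (proj₂ phase₁)) (length-cube l)) (trans (proj₁ (proj₂ phase₂)) (cong (σ *_) (length-cube k))) ⟩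
    σ * 2 * 2 ^ l + σ * 2 ^ k ≡⟨ regroup σ (2 ^ l) ⟩
    6 * σ * 2 ^ l ∎
    where
    open ≡-Reasoning
    regroup : ∀ σ h → σ * 2 * h + σ * (2 * (2 * h)) ≡ 6 * σ * h
    regroup = solve-∀

  hard : ∀ f → (∀ v → 1 ≤ f v × f v ≤ N) → ¬ Distinguishes f edges
  hard f bounds dist-f =
    let e , e∈ , killed = proj₂ (proj₂ phase₂) w (∈-F w inj)
        c , c∈ , kills = any-true⁻ (λ c → B.kills w c e) blocks killed
        d , same = B.kills⇒hits w {c} e kills
    in dist-w (∈-block c∈ d) (∈-killer e∈) (B.kills⇒≢ w {c} e kills ∘ Vec.++-injectiveˡ c (proj₁ e)) (sym same)
    where
    w : Labelling
    w = proj₁ (encode f bounds)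
    dist-w : Distinguishes (label w) edges
    dist-w {e} {e′} e∈ e′∈ e≢e′ eq = dist-f e∈ e′∈ e≢e′
      (trans (sym (labelSum-cong e (proj₂ (encode f bounds)))) (trans eq (labelSum-cong e′ (proj₂ (encode f bounds)))))
    ∈-block : ∀ {c} → c ∈ blocks → ∀ d → c Vec.++ d ∈ edges
    ∈-block c∈ d = ∈-++⁺ˡ (∈-cartesianProductWith⁺ Vec._++_ c∈ (∈-cube d))
    ∈-killer : ∀ {e} → e ∈ killers → proj₁ e Vec.++ proj₂ e ∈ edges
    ∈-killer e∈ = ∈-++⁺ʳ (cartesianProductWith Vec._++_ blocks ds) (∈-map⁺ (uncurry Vec._++_) e∈)
    element : ∀ (xs : List (Subset k)) → 0 < length xs → Σ (Subset k) (_∈ xs)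
    element (x ∷ xs) _ = x , here refl
    -- `σ>0` provides a block, in which a labelling that is not injective on 2^Y already fails.
    some-block : Σ (Subset k) (_∈ blocks)
    some-block = element blocks (subst (0 <_) (sym (proj₁ (proj₂ phase₁))) (*-mono-< σ>0 (s≤s (z≤n {1}))))
    inj : Inj w
    inj = All.tabulate λ {d} _ → All.tabulate λ {d′} _ eq → decidable-stable (d ≟ˢ d′) λ d≢d′ →
      let c , c∈ = some-block in
      dist-w (∈-block c∈ d) (∈-block c∈ d′) (d≢d′ ∘ Vec.++-injectiveʳ c c)
        (trans (labelSum-++ c d (label w)) (trans (cong (labelSum c (λ v → label w (v ↑ˡ l)) +_) eq) (sym (labelSum-++ c d′ (label w)))))

UndistinguishableEdges : ℕ → ℕ → ℕ → Set
UndistinguishableEdges l N σ = Σ (List (Subset (2 + l + l))) λ E → length E ≡ 6 * σ * 2 ^ l ×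
  (∀ f → (∀ v → 1 ≤ f v × f v ≤ N) → ¬ Distinguishes f E)

undistinguishable-edges : ∀ l N σ → (2 + l + l) * N < 2 ^ (2 * l) → N ^ (2 + l + l) < 2 ^ σ → 0 < σ →
  UndistinguishableEdges l N σ
undistinguishable-edges l N σ small few σ>0 = H.edges , H.length-edges , H.hard
  where module H = Hard l N σ small few σ>0

-- Extension to n vertices and m edges

pad : ∀ r {k} → Subset k → Subset (r + k)
pad zero e = e
pad (suc r) e = false ∷ pad r e

pad-injective : ∀ r {k} {e e′ : Subset k} → pad r e ≡ pad r e′ → e ≡ e′
pad-injective zero eq = eq
pad-injective (suc r) eq = pad-injective r (Vec.∷-injectiveʳ eq)

labelSum-pad : ∀ r {k} (e : Subset k) f → labelSum (pad r e) f ≡ labelSum e (λ v → f (r ↑ʳ v))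
labelSum-pad zero e f = refl
labelSum-pad (suc r) e f = labelSum-pad r e (f ∘ suc)

extend-unique : ∀ {n m} (E : List (Subset n)) → Unique E → length E ≤ m → m ≤ 2 ^ n →
  Σ (List (Subset n)) λ E′ → Unique E′ × length E′ ≡ m × (∀ {e} → e ∈ E → e ∈ E′)
extend-unique {n} {m} E uE E≤m m≤ = E ++ take missing fresh ,
  ++⁺ uE (take⁺ missing (filter⁺ _ (cube-unique n))) disjoint , length-eq , ∈-++⁺ˡ
  where
  open ≤-Reasoning
  isOld : Subset n → Bool
  isOld x = any (λ e → does (x ≟ˢ e)) E
  missing = m ∸ length E
  fresh = filterᵇ (not ∘ isOld) (cube n)
  does-sound : ∀ {x e : Subset n} → does (x ≟ˢ e) ≡ true → x ≡ e
  does-sound {x} {e} eq with x ≟ˢ e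
  ... | yes p = p
  does-refl : ∀ (x : Subset n) → does (x ≟ˢ x) ≡ true
  does-refl x with x ≟ˢ x
  ... | yes _ = refl
  ... | no x≢x = contradiction refl x≢x
  ∈-take⁻ : ∀ k (xs : List (Subset n)) {x} → x ∈ take k xs → x ∈ xs
  ∈-take⁻ (suc k) (y ∷ xs) (here eq) = here eq
  ∈-take⁻ (suc k) (y ∷ xs) (there x∈) = there (∈-take⁻ k xs x∈)
  disjoint : ∀ {x} → ¬ (x ∈ E × x ∈ take missing fresh)
  disjoint {x} (x∈E , x∈fresh) = true≢false (any-true⁺ (λ e → does (x ≟ˢ e)) x∈E (does-refl x))
    (not-true (proj₂ (∈-filterᵇ⁻ (not ∘ isOld) (cube n) (∈-take⁻ missing fresh x∈fresh))))
  olds : length (filterᵇ isOld (cube n)) ≤ length E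
  olds = begin
    length (filterᵇ isOld (cube n)) ≡⟨ length-filterᵇ isOld (cube n) ⟩
    ∑ (cube n) (𝟙 ∘ isOld) ≤⟨ ∑-mono (cube n) (λ x _ → any≤∑ (λ e → does (x ≟ˢ e)) E) ⟩
    ∑ (cube n) (λ x → ∑ E (λ e → 𝟙 (does (x ≟ˢ e)))) ≡⟨ ∑-swap (cube n) E (λ x e → 𝟙 (does (x ≟ˢ e))) ⟩
    ∑ E (λ e → ∑ (cube n) (λ x → 𝟙 (does (x ≟ˢ e)))) ≤⟨ ∑-mono E (λ e _ → ∑-at-most-one (λ x → does (x ≟ˢ e)) (cube n)
      (cube-unique n) (λ _ _ px py → trans (does-sound px) (sym (does-sound py)))) ⟩
    ∑ E (λ _ → 1) ≡⟨ trans (∑-const E 1) (*-identityʳ (length E)) ⟩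
    length E ∎
  enough : missing ≤ length fresh
  enough = m≤n+o⇒m∸n≤o m (length E) (begin
    m ≤⟨ m≤ ⟩
    2 ^ n ≡⟨ sym (length-cube n) ⟩
    length (cube n) ≡⟨ sym (length-filterᵇ-+ isOld (cube n)) ⟩
    length (filterᵇ isOld (cube n)) + length fresh ≤⟨ +-monoˡ-≤ (length fresh) olds ⟩
    length E + length fresh ∎)
  length-eq : length (E ++ take missing fresh) ≡ m
  length-eq = trans (length-++ E) (trans (cong (length E +_) (trans (length-take missing fresh) (m≤n⇒m⊓n≡m enough)))
    (m+[n∸m]≡n E≤m))

lookup-unique : ∀ {xs : List A} → Unique xs → ∀ i j → List.lookup xs i ≡ List.lookup xs j → i ≡ j
lookup-unique (x∉ ∷ u) zero zero eq = refl
lookup-unique (x∉ ∷ u) zero (suc j) eq = contradiction eq (All.lookup x∉ (∈-lookup j))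
lookup-unique (x∉ ∷ u) (suc i) zero eq = contradiction (sym eq) (All.lookup x∉ (∈-lookup i))
lookup-unique (x∉ ∷ u) (suc i) (suc j) eq = cong suc (lookup-unique u i j eq)

fromList : ∀ {n} (E : List (Subset n)) → Unique E →
  Σ (Hypergraph n (length E)) λ H → ∀ f → SumDistinguishing H f → Distinguishes f E
fromList E u = record { edge = List.lookup E ; distinct = λ i j i≢j eq → i≢j (lookup-unique u i j eq) } ,
  λ f sd {e} {e′} e∈ e′∈ e≢e′ eq → sd (index e∈) (index e′∈)
    (λ i≡j → e≢e′ (trans (lookup-index e∈) (trans (cong (List.lookup E) i≡j) (sym (lookup-index e′∈)))))
    (trans (cong (λ s → labelSum s f) (sym (lookup-index e∈))) (trans eq (cong (λ s → labelSum s f) (lookup-index e′∈))))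

embed : ∀ {k} r m (E : List (Subset k)) → length E ≤ m → m ≤ 2 ^ (r + k) →
  Σ (Hypergraph (r + k) m) λ H → ∀ f → SumDistinguishing H f → Distinguishes (λ v → f (r ↑ʳ v)) E
embed {k} r m E E≤m m≤ with extend-unique (deduplicate _≟ˢ_ (map (pad r) E)) (deduplicate-! _≟ˢ_ (map (pad r) E))
  (≤-trans (length-deduplicate _≟ˢ_ (map (pad r) E)) (≤-trans (≤-reflexive (length-map (pad r) E)) E≤m)) m≤
... | E′ , u , refl , ⊆E′ with fromList E′ u
...   | H , distH = H , λ f sd {e} {e′} e∈ e′∈ e≢e′ eq → distH f sd (∈E′ e∈) (∈E′ e′∈) (e≢e′ ∘ pad-injective r)
  (trans (labelSum-pad r e f) (trans eq (sym (labelSum-pad r e′ f))))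
  where
  ∈E′ : ∀ {e} → e ∈ E → pad r e ∈ E′
  ∈E′ e∈ = ⊆E′ (∈-deduplicate⁺ _≟ˢ_ (∈-map⁺ (pad r) e∈))

unlabelable : ∀ {k} r m N (E : List (Subset k)) →
  (∀ f → (∀ v → 1 ≤ f v × f v ≤ N) → ¬ Distinguishes f E) → length E ≤ m → m ≤ 2 ^ (r + k) →
  Σ (Hypergraph (r + k) m) λ H → ¬ Labelable H N
unlabelable r m N E hard E≤m m≤ = let H , distH = embed r m E E≤m m≤ in
  H , λ (f , bounds , sd) → hard (λ v → f (r ↑ʳ v)) (λ v → bounds (r ↑ʳ v)) (distH f sd)

-- Parameters of the lower bound

binary-log : ∀ m → 1 ≤ m → Σ ℕ λ g → 2 ^ g ≤ m × m < 2 ^ suc g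
binary-log (suc zero) _ = 0 , ≤-refl , ≤-refl
binary-log (suc (suc m)) _ with binary-log (suc m) (s≤s z≤n)
... | g , l , u with 2 + m <? 2 ^ suc g
...   | yes lt = g , ≤-trans l (n≤1+n _) , lt
...   | no ge = suc g , ≮⇒≥ ge , <-≤-trans (s≤s u) (+-mono-≤ (m^n>0 2 (suc g)) (m≤m+n (2 ^ suc g) 0))

2^-cancel-< : ∀ {a b} → 2 ^ a < 2 ^ b → a < b
2^-cancel-< lt = ≰⇒> λ b≤a → <⇒≱ lt (^-monoʳ-≤ 2 b≤a)

2^-suc : ∀ a → 2 ^ a < 2 ^ suc a
2^-suc a = ^-monoʳ-< 2 (s≤s (s≤s z≤n)) (n<1+n a)

square≤2^ : ∀ y → (4 + y) * (4 + y) ≤ 2 ^ (4 + y)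
square≤2^ zero = ≤-refl
square≤2^ (suc y) = begin
  (5 + y) * (5 + y) ≤⟨ m≤m+n _ (7 + 6 * y + y * y) ⟩
  (5 + y) * (5 + y) + (7 + 6 * y + y * y) ≡⟨ expand y ⟩
  2 * ((4 + y) * (4 + y)) ≤⟨ *-monoʳ-≤ 2 (square≤2^ y) ⟩
  2 ^ (5 + y) ∎
  where
  open ≤-Reasoning
  expand : ∀ y → (5 + y) * (5 + y) + (7 + 6 * y + y * y) ≡ 2 * ((4 + y) * (4 + y))
  expand = solve-∀

-- For positive `x`, `5 * x + 19 ≤ 24 * x`, whence the 24; the 4 is where squares begin to stay
-- below powers of two.
linear≤2^ : ∀ a x → 24 * a + 4 ≤ x → a * (5 * x + 19) ≤ 2 ^ x
linear≤2^ a x large = begin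
  a * (5 * x + 19) ≤⟨ *-monoʳ-≤ a (+-monoʳ-≤ (5 * x) (*-monoʳ-≤ 19 x>0)) ⟩
  a * (5 * x + 19 * x) ≡⟨ regroup a x ⟩
  24 * a * x ≤⟨ *-monoˡ-≤ x (≤-trans (m≤m+n (24 * a) 4) large) ⟩
  x * x ≡⟨ cong (λ y → y * y) (sym 4+y≡x) ⟩
  (4 + y) * (4 + y) ≤⟨ square≤2^ y ⟩
  2 ^ (4 + y) ≡⟨ cong (2 ^_) 4+y≡x ⟩
  2 ^ x ∎
  where
  open ≤-Reasoning
  4≤x : 4 ≤ x
  4≤x = ≤-trans (m≤n+m 4 (24 * a)) large
  x>0 : 1 ≤ x
  x>0 = ≤-trans (s≤s z≤n) 4≤x
  y = x ∸ 4
  4+y≡x : 4 + y ≡ x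
  4+y≡x = m+[n∸m]≡n 4≤x
  regroup : ∀ a x → a * (5 * x + 19 * x) ≡ 24 * a * x
  regroup = solve-∀

^-distribʳ-* : ∀ n a b → (a * b) ^ n ≡ a ^ n * b ^ n
^-distribʳ-* zero a b = refl
^-distribʳ-* (suc n) a b = trans (cong (a * b *_) (^-distribʳ-* n a b)) (regroup a b (a ^ n) (b ^ n))
  where
  regroup : ∀ a b x y → a * b * (x * y) ≡ a * x * (b * y)
  regroup = solve-∀

module _ (q l e γ r m : ℕ) where

  private
    Q g k n σ N : ℕ
    Q = suc q
    -- From `k ≤ 2 ^ suc γ` follows `6 * σ ≤ 8 * k * k ≤ 2 ^ (2 * γ + 5)`, so the `6 * σ * 2 ^ l`
    -- edges number at most `2 ^ g ≤ m`.
    g = l + (2 * γ + 5)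
    k = 2 + l + l
    n = r + k
    σ = suc (2 * l * k)
    -- The exponent `e` will be `2 * l` less γ + 2: a sum of `k` labels costs γ + 1, and one more
    -- bit makes the bound `small` strict.
    N = 2 ^ e

  -- Here g and γ - 1 are the binary logarithms of m and g, and N is m² up to a polynomial in g.
  lower-at : e + (γ + 2) ≡ 2 * l → g < 2 ^ γ → Q * (5 * γ + 14) ≤ g → 2 ^ g ≤ m → m < 2 ^ suc g → suc g ≤ n →
    m ^ (2 * Q) ≤ N ^ Q * m × Σ (Hypergraph n m) λ H → ¬ Labelable H N
  lower-at e-eq g<2^γ Q≤g 2^g≤m m<2^g g<n = size-bound ,
    assemble (undistinguishable-edges l N σ small few (s≤s z≤n))
    where
    open ≤-Reasoning
    1+l≤2^γ : 1 + l ≤ 2 ^ γ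
    1+l≤2^γ = ≤-trans (s≤s (m≤m+n l (2 * γ + 5))) g<2^γ
    k≤ : k ≤ 2 ^ suc γ
    k≤ = begin
      2 + l + l ≡⟨ regroup l ⟩
      2 * (1 + l) ≤⟨ *-monoʳ-≤ 2 1+l≤2^γ ⟩
      2 ^ suc γ ∎
      where
      regroup : ∀ l → 2 + l + l ≡ 2 * (1 + l)
      regroup = solve-∀
    small : k * N < 2 ^ (2 * l)
    small = begin-strict
      k * N ≤⟨ *-monoˡ-≤ N k≤ ⟩
      2 ^ suc γ * 2 ^ e ≡⟨ sym (^-distribˡ-+-* 2 (suc γ) e) ⟩
      2 ^ (suc γ + e) <⟨ 2^-suc (suc γ + e) ⟩
      2 ^ suc (suc γ + e) ≡⟨ cong (2 ^_) (trans (regroup γ e) e-eq) ⟩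
      2 ^ (2 * l) ∎
      where
      regroup : ∀ γ e → suc (suc γ + e) ≡ e + (γ + 2)
      regroup = solve-∀
    few : N ^ k < 2 ^ σ
    few = begin-strict
      (2 ^ e) ^ k ≡⟨ ^-*-assoc 2 e k ⟩
      2 ^ (e * k) ≤⟨ ^-monoʳ-≤ 2 (*-monoˡ-≤ k (≤-trans (m≤m+n e (γ + 2)) (≤-reflexive e-eq))) ⟩
      2 ^ (2 * l * k) <⟨ 2^-suc (2 * l * k) ⟩
      2 ^ σ ∎
    σ≤ : σ ≤ 2 ^ suc γ * 2 ^ suc γ
    σ≤ = begin
      σ ≤⟨ m≤m+n σ (4 * l + 3) ⟩
      σ + (4 * l + 3) ≡⟨ regroup l ⟩
      k * k ≤⟨ *-mono-≤ k≤ k≤ ⟩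
      2 ^ suc γ * 2 ^ suc γ ∎
      where
      regroup : ∀ l → suc (2 * l * (2 + l + l)) + (4 * l + 3) ≡ (2 + l + l) * (2 + l + l)
      regroup = solve-∀
    edges≤m : 6 * σ * 2 ^ l ≤ m
    edges≤m = begin
      6 * σ * 2 ^ l ≤⟨ *-monoˡ-≤ (2 ^ l) {6 * σ} {8 * (2 ^ suc γ * 2 ^ suc γ)} (*-mono-≤ {6} {8} (m≤m+n 6 2) σ≤) ⟩
      8 * (2 ^ suc γ * 2 ^ suc γ) * 2 ^ l ≡⟨ powers-product (suc γ) l ⟩
      2 ^ (3 + (suc γ + suc γ) + l) ≡⟨ cong (2 ^_) (regroup γ l) ⟩
      2 ^ g ≤⟨ 2^g≤m ⟩
      m ∎
      where
      regroup : ∀ γ l → 3 + (suc γ + suc γ) + l ≡ l + (2 * γ + 5)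
      regroup = solve-∀
      powers-product : ∀ γ l → 8 * (2 ^ γ * 2 ^ γ) * 2 ^ l ≡ 2 ^ (3 + (γ + γ) + l)
      powers-product γ l = begin-equality
        8 * (2 ^ γ * 2 ^ γ) * 2 ^ l ≡⟨ cong (λ x → 8 * x * 2 ^ l) (sym (^-distribˡ-+-* 2 γ γ)) ⟩
        2 ^ 3 * 2 ^ (γ + γ) * 2 ^ l ≡⟨ cong (_* 2 ^ l) (sym (^-distribˡ-+-* 2 3 (γ + γ))) ⟩
        2 ^ (3 + (γ + γ)) * 2 ^ l ≡⟨ sym (^-distribˡ-+-* 2 (3 + (γ + γ)) l) ⟩
        2 ^ (3 + (γ + γ) + l) ∎
    assemble : UndistinguishableEdges l N σ → Σ (Hypergraph n m) λ H → ¬ Labelable H N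
    assemble (E , length-E , hard) = unlabelable r m N E hard
      (subst (_≤ m) (sym length-E) edges≤m) (≤-trans (<⇒≤ m<2^g) (^-monoʳ-≤ 2 g<n))
    -- The factor lost against `m * m` is polynomial in `g`. Since `Q * (5 * γ + 14) ≤ g`, its Q-th
    -- power is at most `m`, which is the loss allowed for ε = 1/Q.
    m²≤ : m * m ≤ N * 2 ^ (5 * γ + 14)
    m²≤ = begin
      m * m ≤⟨ *-mono-≤ (<⇒≤ m<2^g) (<⇒≤ m<2^g) ⟩
      2 ^ suc g * 2 ^ suc g ≡⟨ sym (^-distribˡ-+-* 2 (suc g) (suc g)) ⟩
      2 ^ (suc g + suc g) ≡⟨ cong (2 ^_) (trans (regroup₁ l γ) (trans (cong (_+ (4 * γ + 12)) (sym e-eq)) (regroup₂ e γ))) ⟩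
      2 ^ (e + (5 * γ + 14)) ≡⟨ ^-distribˡ-+-* 2 e (5 * γ + 14) ⟩
      N * 2 ^ (5 * γ + 14) ∎
      where
      regroup₁ : ∀ l γ → suc (l + (2 * γ + 5)) + suc (l + (2 * γ + 5)) ≡ 2 * l + (4 * γ + 12)
      regroup₁ = solve-∀
      regroup₂ : ∀ e γ → e + (γ + 2) + (4 * γ + 12) ≡ e + (5 * γ + 14)
      regroup₂ = solve-∀
    size-bound : m ^ (2 * Q) ≤ N ^ Q * m
    size-bound = begin
      m ^ (2 * Q) ≡⟨ sym (^-*-assoc m 2 Q) ⟩
      (m ^ 2) ^ Q ≡⟨ cong (λ x → (m * x) ^ Q) (*-identityʳ m) ⟩
      (m * m) ^ Q ≤⟨ ^-monoˡ-≤ Q m²≤ ⟩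
      (N * 2 ^ (5 * γ + 14)) ^ Q ≡⟨ ^-distribʳ-* Q N (2 ^ (5 * γ + 14)) ⟩
      N ^ Q * (2 ^ (5 * γ + 14)) ^ Q ≡⟨ cong (N ^ Q *_) (^-*-assoc 2 (5 * γ + 14) Q) ⟩
      N ^ Q * 2 ^ ((5 * γ + 14) * Q) ≤⟨ *-monoʳ-≤ (N ^ Q) (^-monoʳ-≤ 2 (≤-trans (≤-reflexive (*-comm (5 * γ + 14) Q)) Q≤g)) ⟩
      N ^ Q * 2 ^ g ≤⟨ *-monoʳ-≤ (N ^ Q) 2^g≤m ⟩
      N ^ Q * m ∎

lower : ∀ q → Σ ℕ λ m₀ → ∀ n m → m₀ ≤ m → m ≤ n ^ suc q →
  Σ ℕ λ N → m ^ (2 * suc q) ≤ N ^ suc q * m × Σ (Hypergraph n m) λ H → ¬ Labelable H N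
lower q = 2 ^ 2 ^ γ₀ , bound
  where
  Q = suc q
  -- For `m` at least `2 ^ 2 ^ γ₀`, the iterated binary logarithm `γ′` is at least `γ₀`, the
  -- threshold at which `linear≤2^` yields `Q≤g`.
  γ₀ = 24 * Q + 4
  bound : ∀ n m → 2 ^ 2 ^ γ₀ ≤ m → m ≤ n ^ Q →
    Σ ℕ λ N → m ^ (2 * Q) ≤ N ^ Q * m × Σ (Hypergraph n m) λ H → ¬ Labelable H N
  bound n m m₀≤m m≤n^Q
    with binary-log m (≤-trans (m^n>0 2 (2 ^ γ₀)) m₀≤m)
  ... | g , 2^g≤m , m<2^g with binary-log g (≤-trans (m^n>0 2 γ₀) (≤-pred (2^-cancel-< (≤-<-trans m₀≤m m<2^g))))
  ...   | γ′ , 2^γ′≤g , g<2^γ = with-padding (n ∸ k) (m∸n+n≡m k≤n)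
    where
    open ≤-Reasoning
    γ = suc γ′
    γ₀≤γ′ : γ₀ ≤ γ′
    γ₀≤γ′ = ≤-pred (2^-cancel-< (≤-<-trans (≤-pred (2^-cancel-< {2 ^ γ₀} (≤-<-trans m₀≤m m<2^g))) g<2^γ))
    Q≤g : Q * (5 * γ + 14) ≤ g
    Q≤g = begin
      Q * (5 * γ + 14) ≡⟨ cong (Q *_) (regroup γ′) ⟩
      Q * (5 * γ′ + 19) ≤⟨ linear≤2^ Q γ′ γ₀≤γ′ ⟩
      2 ^ γ′ ≤⟨ 2^γ′≤g ⟩
      g ∎
      where
      regroup : ∀ x → 5 * suc x + 14 ≡ 5 * x + 19
      regroup = solve-∀
    5γ≤g : 5 * γ + 14 ≤ g
    5γ≤g = ≤-trans (m≤m+n (5 * γ + 14) _) Q≤g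
    split₁ : ∀ γ → 5 * γ + 14 ≡ (γ + 2) + (2 * γ + 7) + (2 * γ + 5)
    split₁ = solve-∀
    2γ+5≤g : 2 * γ + 5 ≤ g
    2γ+5≤g = ≤-trans (m≤n+m (2 * γ + 5) ((γ + 2) + (2 * γ + 7))) (≤-trans (≤-reflexive (sym (split₁ γ))) 5γ≤g)
    l = g ∸ (2 * γ + 5)
    g-eq : l + (2 * γ + 5) ≡ g
    g-eq = m∸n+n≡m 2γ+5≤g
    γ+2≤l : γ + 2 ≤ l
    γ+2≤l = +-cancelʳ-≤ (2 * γ + 5) _ _ (begin
      γ + 2 + (2 * γ + 5) ≤⟨ +-monoˡ-≤ (2 * γ + 5) (m≤m+n (γ + 2) (2 * γ + 7)) ⟩
      (γ + 2) + (2 * γ + 7) + (2 * γ + 5) ≡⟨ sym (split₁ γ) ⟩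
      5 * γ + 14 ≤⟨ 5γ≤g ⟩
      g ≡⟨ sym g-eq ⟩
      l + (2 * γ + 5) ∎)
    e = 2 * l ∸ (γ + 2)
    e-eq : e + (γ + 2) ≡ 2 * l
    e-eq = m∸n+n≡m (≤-trans γ+2≤l (m≤m+n l _))
    k = 2 + l + l
    l<g : suc l ≤ g
    l<g = subst (suc l ≤_) g-eq (subst (_≤ l + (2 * γ + 5)) (+-comm l 1) (+-monoʳ-≤ l (≤-trans (s≤s z≤n) (m≤n+m 5 (2 * γ)))))
    -- Here `m ≤ n ^ Q` enters: if `n` were below `2 * g`, then `n ^ Q` would be bounded by a power
    -- of `g`, which is less than `2 ^ g ≤ m`. So there is room for the logarithmically many
    -- vertices.
    2g≤n : 2 * g ≤ n
    2g≤n with 2 * g ≤? n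
    ... | yes le = le
    ... | no gt = contradiction m≤n^Q (<⇒≱ (begin-strict
      n ^ Q ≤⟨ ^-monoˡ-≤ Q (≤-trans (<⇒≤ (≰⇒> gt)) (*-monoʳ-≤ 2 (<⇒≤ g<2^γ))) ⟩
      (2 ^ suc γ) ^ Q ≡⟨ ^-*-assoc 2 (suc γ) Q ⟩
      2 ^ (suc γ * Q) <⟨ ^-monoʳ-< 2 (s≤s (s≤s z≤n)) (<-≤-trans exponent Q≤g) ⟩
      2 ^ g ≤⟨ 2^g≤m ⟩
      m ∎))
      where
      exponent : suc γ * Q < Q * (5 * γ + 14)
      exponent = begin-strict
        suc γ * Q ≡⟨ *-comm (suc γ) Q ⟩
        Q * suc γ <⟨ *-monoʳ-< Q (m<m+n (suc γ) (s≤s z≤n)) ⟩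
        Q * (suc γ + suc (4 * γ + 12)) ≡⟨ cong (Q *_) (regroup γ) ⟩
        Q * (5 * γ + 14) ∎
        where
        regroup : ∀ γ → suc γ + suc (4 * γ + 12) ≡ 5 * γ + 14
        regroup = solve-∀
    k≤n : k ≤ n
    k≤n = ≤-trans (subst (_≤ 2 * g) (double l) (*-monoʳ-≤ 2 l<g)) 2g≤n
      where
      double : ∀ l → 2 * suc l ≡ 2 + l + l
      double = solve-∀
    g<n : suc g ≤ n
    g<n = ≤-trans (subst (_≤ 2 * g) (+-comm g 1) (+-monoʳ-≤ g (≤-trans (≤-trans (s≤s z≤n) l<g) (m≤m+n g 0)))) 2g≤n
    with-padding : ∀ r → r + k ≡ n → Σ ℕ λ N → m ^ (2 * Q) ≤ N ^ Q * m × Σ (Hypergraph n m) λ H → ¬ Labelable H N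
    with-padding r r+k≡n = 2 ^ e ,
      subst (λ n → m ^ (2 * Q) ≤ (2 ^ e) ^ Q * m × Σ (Hypergraph n m) λ H → ¬ Labelable H (2 ^ e)) r+k≡n
        (lower-at q l e γ r m e-eq (subst (_< 2 ^ γ) (sym g-eq) g<2^γ) (subst (Q * (5 * γ + 14) ≤_) (sym g-eq) Q≤g)
          (subst (λ g → 2 ^ g ≤ m) (sym g-eq) 2^g≤m) (subst (λ g → m < 2 ^ suc g) (sym g-eq) m<2^g)
          (subst₂ (λ g n → suc g ≤ n) (sym g-eq) (sym r+k≡n) g<n))

-- Existence of s(n, m)

-- A hypergraph rebuilt from a listed vector of edges agrees with the original only edge by edge.
labelable-cong : ∀ {n m} (H H′ : Hypergraph n m) {N} → (∀ i → edge H i ≡ edge H′ i) → Labelable H N → Labelable H′ N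
labelable-cong H H′ eq (f , bounds , sd) = f , bounds , λ i j i≢j same →
  sd i j i≢j (trans (cong (λ e → labelSum e f) (eq i)) (trans same (cong (λ e → labelSum e f) (sym (eq j)))))

labelable-mono : ∀ {n m} (H : Hypergraph n m) {N N′} → N ≤ N′ → Labelable H N → Labelable H N′
labelable-mono H N≤N′ (f , bounds , sd) = f , (λ v → proj₁ (bounds v) , ≤-trans (proj₂ (bounds v)) N≤N′) , sd

-- The extrema defining s(n, m) are found by search; a bound on the labels leaves finitely many
-- vectors to test.
labelable? : ∀ {n m} (H : Hypergraph n m) N → Dec (Labelable H N)
labelable? {n} {m} H N = map′ to from (any? sd? (vecs (allFin N) n))
  where
  sd? : (w : Vec (Fin N) n) → Dec (SumDistinguishing H (label w))
  sd? w = Fin.all? λ i → Fin.all? λ j →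
    ¬? (i Fin.≟ j) →-dec ¬? (labelSum (edge H i) (label w) ≟ labelSum (edge H j) (label w))
  to : Any.Any (λ w → SumDistinguishing H (label w)) (vecs (allFin N) n) → Labelable H N
  to found = let w , _ , sd = find found in label w , (λ v → s≤s z≤n , label≤ w v) , sd
  from : Labelable H N → Any.Any (λ w → SumDistinguishing H (label w)) (vecs (allFin N) n)
  from (f , bounds , sd) = let w , eq = encode f bounds in
    lose (∈-vecs ∈-allFin w) λ i j i≢j same →
      sd i j i≢j (trans (sym (labelSum-cong (edge H i) eq)) (trans same (labelSum-cong (edge H j) eq)))

unlabelable? : ∀ n m N → Dec (Σ (Hypergraph n m) λ H → ¬ Labelable H N)
unlabelable? n m N = map′ to from (any? bad? (vecs (cube n) m))
  where
  Distinct : Vec (Subset n) m → Set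
  Distinct es = ∀ i j → i ≢ j → lookup es i ≢ lookup es j
  hypergraph : ∀ es → Distinct es → Hypergraph n m
  hypergraph es d = record { edge = lookup es ; distinct = d }
  Bad : Vec (Subset n) m → Set
  Bad es = Σ (Distinct es) λ d → ¬ Labelable (hypergraph es d) N
  bad? : ∀ es → Dec (Bad es)
  bad? es with Fin.all? (λ i → Fin.all? (λ j → ¬? (i Fin.≟ j) →-dec ¬? (lookup es i ≟ˢ lookup es j)))
  ... | no ¬d = no (¬d ∘ proj₁)
  ... | yes d with labelable? (hypergraph es d) N
  ...   | yes l = no λ (_ , ¬l) → ¬l l
  ...   | no ¬l = yes (d , ¬l)
  to : Any.Any Bad (vecs (cube n) m) → Σ (Hypergraph n m) λ H → ¬ Labelable H N
  to found = let es , _ , d , ¬l = find found in hypergraph es d , ¬l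
  from : (Σ (Hypergraph n m) λ H → ¬ Labelable H N) → Any.Any Bad (vecs (cube n) m)
  from (H , ¬l) = lose (∈-vecs ∈-cube es) (d , λ l → ¬l (labelable-cong (hypergraph es d) H eq l))
    where
    es = tabulate (edge H)
    eq : ∀ i → lookup es i ≡ edge H i
    eq = lookup∘tabulate (edge H)
    d : Distinct es
    d i j i≢j same = distinct H i j i≢j (trans (sym (eq i)) (trans same (eq j)))

least : ∀ {P : ℕ → Set} → (∀ n → Dec (P n)) → ∀ u → P u → Σ ℕ λ s → P s × (∀ n → P n → s ≤ n)
least P? zero p = 0 , p , λ _ _ → z≤n
least P? (suc u) p with P? 0
... | yes p₀ = 0 , p₀ , λ _ _ → z≤n
... | no ¬p₀ = let s , ps , min = least (P? ∘ suc) u p in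
  suc s , ps , λ { zero p₀ → contradiction p₀ ¬p₀ ; (suc n) pn → s≤s (min n pn) }

all-labelable? : ∀ n m N → Dec (∀ (H : Hypergraph n m) → Labelable H N)
all-labelable? n m N with unlabelable? n m N
... | yes (H , ¬l) = no λ all → ¬l (all H)
... | no none = yes λ H → decidable-stable (labelable? H N) λ ¬l → none (H , ¬l)

-- s(n, m) is the least S that suffices for all hypergraphs; it is attained because
-- some hypergraph is not labelable with S - 1.
snm-between : ∀ n m U N → (∀ (H : Hypergraph n m) → Labelable H U) → (Σ (Hypergraph n m) λ H → ¬ Labelable H N) →
  Σ ℕ λ S → IsSnm n m S × N < S × S ≤ U
snm-between n m U N all (H₀ , ¬l₀) with least (all-labelable? n m) U all
... | zero , all₀ , _ = ⊥-elim (¬l₀ (labelable-mono H₀ z≤n (all₀ H₀)))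
... | suc S , allS , min with unlabelable? n m S
...   | no none = contradiction (min S λ H → decidable-stable (labelable? H S) λ ¬l → none (H , ¬l)) (<⇒≱ ≤-refl)
...   | yes (H , ¬l) = suc S ,
  ((H , allS H , λ N′ l → ≰⇒> λ N′≤S → ¬l (labelable-mono H N′≤S l)) ,
   λ H′ N′ (_ , minimal) → minimal (suc S) (allS H′)) ,
  ≰⇒> (λ S≤N → ¬l₀ (labelable-mono H₀ S≤N (allS H₀))) ,
  min U all

-- Here C = (a+1)/(b+1) and ε = (p+1)/(q+1), with roots and quotients cleared. Rational values
-- suffice, as the claim grows stronger when C increases or ε decreases. For the same reason the
-- proof works with a+1 in place of C and 1/(q+1) in place of ε.
theorem1 : ∀ (a b p q : ℕ) → Σ ℕ λ n₀ → ∀ (n m : ℕ) → n₀ < n → n ≤ m → m ^ suc p ≤ n ^ suc q →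
    Σ ℕ λ S → IsSnm n m S
    × (m ^ (2 * suc q) ≤ S ^ suc q * m ^ suc p)
    × (suc a * S ≤ suc b * (m * m))
theorem1 a b p q = m₀ + m₁ , bounds
  where
  open ≤-Reasoning
  m₀ = proj₁ (lower q)
  m₁ = proj₁ (upper (suc a))
  bounds : ∀ n m → m₀ + m₁ < n → n ≤ m → m ^ suc p ≤ n ^ suc q →
    Σ ℕ λ S → IsSnm n m S × (m ^ (2 * suc q) ≤ S ^ suc q * m ^ suc p) × (suc a * S ≤ suc b * (m * m))
  bounds n m n₀<n n≤m m^p≤n^q =
    let N , lower-bound , unlabelled = proj₂ (lower q) n m (≤-trans (m≤m+n m₀ m₁) n₀≤m) (≤-trans m≤m^p m^p≤n^q)
        U , upper-bound , labelled = proj₂ (upper (suc a)) m (≤-trans (m≤n+m m₁ m₀) n₀≤m)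
        S , isS , N<S , S≤U = snm-between n m U N labelled unlabelled
    in S , isS ,
      ≤-trans lower-bound (*-mono-≤ (^-monoˡ-≤ (suc q) (<⇒≤ N<S)) m≤m^p) ,
      ≤-trans (*-monoʳ-≤ (suc a) S≤U) (≤-trans upper-bound (m≤m+n (m * m) (b * (m * m))))
    where
    n₀≤m : m₀ + m₁ ≤ m
    n₀≤m = ≤-trans (<⇒≤ n₀<n) n≤m
    instance
      m-nonZero : NonZero m
      m-nonZero = >-nonZero (≤-trans (s≤s z≤n) (≤-trans n₀<n n≤m))
    m≤m^p : m ≤ m ^ suc p
    m≤m^p = m≤m*n m (m ^ p) {{m^n≢0 m p}}
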